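{- Let $f(x)\in\mathbf{Z}[x]$ be a nonconstant separable polynomial, let $R(f)$ be the set of all primes $q$ that are good for $f(x)$ and such that $f(x)$ has a root modulo $q$, and let $T$ be a finite subset of $R(f)$. Then there exist infinitely many $d\in\mathcal{S}(f)$ such that $d$ is divisible by every prime in $T$.
   Context: Squarefree integers may be negative and are nonzero. For a nonzero rational number $r$, its squarefree part $S(r)$ is the unique squarefree integer $d$ such that $r/d$ is a square in $\mathbf{Q}$. For a separable nonconstant $f(x)\in\mathbf{Z}[x]$, $\mathcal{S}(f)=\{S(f(r)) : r\in\mathbf{Q},\ f(r)\neq 0\}$. An odd prime $q$ is good for $f(x)$ if the reduced polynomial $\bar f(x)\in\mathbf{F}_q[x]$ has the same degree as $f(x)$ and has nonzero discriminant. -}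

module Defs where

open import Level using (Level; 0ℓ; _⊔_)
open import Algebra.Bundles using (CommutativeRing; Semiring)
import Algebra.Definitions.RawSemiring as RawSemiringDefs
open import Data.Fin.Base as Fin using (Fin; toℕ; opposite; punchIn; splitAt)
open import Data.Integer.Base as ℤ using (ℤ; +_; ∣_∣; 0ℤ)
open import Data.Integer.Divisibility.Signed using (_∣_; divides; ∣m∣n⇒∣m+n; ∣m⇒∣-m; ∣n⇒∣m*n)
import Data.Integer.Properties as ℤₚ
open import Data.Integer.Solver using (module +-*-Solver)
open import Data.List.Base using (List; []; _∷_; _++_; map; replicate)
open import Data.List.Membership.Propositional using (_∉_)
open import Data.Nat.Base as ℕ using (ℕ; zero; suc; _<_; _≤_; ⌊_/2⌋; pred)
open import Data.Nat.Primality using (Prime)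
open import Data.Product.Base using (Σ; ∃-syntax; _×_; _,_)
open import Data.Rational.Base as ℚ using (ℚ; 0ℚ; _÷_)
open import Data.Rational.Literals using (fromℤ)
import Data.Rational.Properties as ℚₚ
open import Data.Sum.Base using ([_,_]′)
open import Relation.Binary.PropositionalEquality using (_≡_; _≢_; refl; sym; subst)
open import Relation.Nullary.Negation using (¬_)

module Polynomial {c ℓ : Level} (R : CommutativeRing c ℓ) where
  open CommutativeRing R
  open RawSemiringDefs (Semiring.rawSemiring semiring) using (_^_; sum)

  -- Coefficients in increasing degree; trailing zeros are allowed, so
  -- polynomials are compared with _≈ₚ_ and the degree is not the length.
  Poly : Set c
  Poly = List Carrier

  coeff : Poly → ℕ → Carrier
  coeff []      _       = 0#
  coeff (a ∷ _) zero    = a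
  coeff (_ ∷ p) (suc k) = coeff p k

  infix 4 _≈ₚ_
  _≈ₚ_ : Poly → Poly → Set ℓ
  p ≈ₚ q = ∀ k → coeff p k ≈ coeff q k

  HasDegree : Poly → ℕ → Set ℓ
  HasDegree p n = ¬ (coeff p n ≈ 0#) × (∀ k → n < k → coeff p k ≈ 0#)

  eval : Poly → Carrier → Carrier
  eval []      _ = 0#
  eval (a ∷ p) x = a + x * eval p x

  infixl 6 _+ₚ_
  _+ₚ_ : Poly → Poly → Poly
  []      +ₚ q       = q
  p       +ₚ []      = p
  (a ∷ p) +ₚ (b ∷ q) = (a + b) ∷ (p +ₚ q)

  infixl 7 _*ₚ_
  _*ₚ_ : Poly → Poly → Poly
  []      *ₚ q = []
  (a ∷ p) *ₚ q = map (a *_) q +ₚ (0# ∷ p *ₚ q)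

  1ₚ : Poly
  1ₚ = 1# ∷ []

  -- (a + x p)′ = p + x p′
  deriv : Poly → Poly
  deriv []      = []
  deriv (a ∷ p) = p +ₚ (0# ∷ deriv p)

  -- f and f′ generate the unit ideal; over a field this says gcd(f , f′) = 1.
  Separable : Poly → Set (c ⊔ ℓ)
  Separable f = ∃[ u ] ∃[ v ] u *ₚ f +ₚ v *ₚ deriv f ≈ₚ 1ₚ

  Matrix : ℕ → Set c
  Matrix n = Fin n → Fin n → Carrier

  -- Laplace expansion along the first row.
  det : ∀ {n} → Matrix n → Carrier
  det {zero}  M = 1#
  det {suc n} M = sum λ j →
    (- 1#) ^ toℕ j * (M Fin.zero j * det λ i k → M (Fin.suc i) (punchIn j k))

  x^_·_ : ℕ → Poly → Poly
  x^ k · p = replicate k 0# ++ p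

  -- Rows xⁿ⁻¹p, …, p, xᵐ⁻¹q, …, q; columns are the coefficients of
  -- xᵐ⁺ⁿ⁻¹, …, 1. Here m and n are the formal degrees of p and q.
  sylvester : (m n : ℕ) → Poly → Poly → Matrix (n ℕ.+ m)
  sylvester m n p q i j =
    coeff ([ (λ k → x^ toℕ (opposite k) · p) , (λ k → x^ toℕ (opposite k) · q) ]′ (splitAt n i))
          (toℕ (opposite j))

  resultant : (m n : ℕ) → Poly → Poly → Carrier
  resultant m n p q = det (sylvester m n p q)

  -- For f of degree n ≥ 1 over a field, D = (-1)^(n(n-1)/2) aₙ⁻¹ Res(f , f′).
  -- f′ is given formal degree n - 1 even when the characteristic divides n,
  -- as in the universal formula for the discriminant.
  IsDiscriminant : (n : ℕ) → Poly → Carrier → Set ℓ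
  IsDiscriminant n f D =
    coeff f n * D ≈ (- 1#) ^ ⌊ n ℕ.* pred n /2⌋ * resultant n (pred n) f (deriv f)

-- ℤ/mℤ as a setoid: the carrier is ℤ and equality is congruence modulo m.
module _ (m : ℕ) where
  open +-*-Solver

  infix 4 _≡ₘ_
  _≡ₘ_ : ℤ → ℤ → Set
  a ≡ₘ b = + m ∣ a ℤ.- b

  private
    ≡⇒≡ₘ : ∀ {a b} → a ≡ b → a ≡ₘ b
    ≡⇒≡ₘ {a} refl = subst (+ m ∣_) (sym (ℤₚ.+-inverseʳ a)) (divides 0ℤ refl)

    ≡ₘ-sym : ∀ {a b} → a ≡ₘ b → b ≡ₘ a
    ≡ₘ-sym {a} {b} p = subst (+ m ∣_)
      (solve 2 (λ a b → :- (a :- b) := b :- a) refl a b) (∣m⇒∣-m p)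

    ≡ₘ-trans : ∀ {a b c} → a ≡ₘ b → b ≡ₘ c → a ≡ₘ c
    ≡ₘ-trans {a} {b} {c} p q = subst (+ m ∣_)
      (solve 3 (λ a b c → (a :- b) :+ (b :- c) := a :- c) refl a b c) (∣m∣n⇒∣m+n p q)

    +-congₘ : ∀ {a b c d} → a ≡ₘ b → c ≡ₘ d → a ℤ.+ c ≡ₘ b ℤ.+ d
    +-congₘ {a} {b} {c} {d} p q = subst (+ m ∣_)
      (solve 4 (λ a b c d → (a :- b) :+ (c :- d) := (a :+ c) :- (b :+ d)) refl a b c d)
      (∣m∣n⇒∣m+n p q)

    *-congₘ : ∀ {a b c d} → a ≡ₘ b → c ≡ₘ d → a ℤ.* c ≡ₘ b ℤ.* d
    *-congₘ {a} {b} {c} {d} p q = subst (+ m ∣_)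
      (solve 4 (λ a b c d → c :* (a :- b) :+ b :* (c :- d) := a :* c :- b :* d) refl a b c d)
      (∣m∣n⇒∣m+n (∣n⇒∣m*n c p) (∣n⇒∣m*n b q))

    -‿congₘ : ∀ {a b} → a ≡ₘ b → ℤ.- a ≡ₘ ℤ.- b
    -‿congₘ {a} {b} p = subst (+ m ∣_)
      (solve 2 (λ a b → :- (a :- b) := (:- a) :- (:- b)) refl a b) (∣m⇒∣-m p)

  ℤ/ : CommutativeRing 0ℓ 0ℓ
  ℤ/ = record
    { Carrier = ℤ
    ; _≈_ = _≡ₘ_
    ; _+_ = ℤ._+_
    ; _*_ = ℤ._*_
    ; -_  = ℤ.-_
    ; 0#  = ℤ.0ℤ
    ; 1#  = ℤ.1ℤ
    ; isCommutativeRing = record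
      { isRing = record
        { +-isAbelianGroup = record
          { isGroup = record
            { isMonoid = record
              { isSemigroup = record
                { isMagma = record
                  { isEquivalence = record
                    { refl  = λ {a} → ≡⇒≡ₘ {a} refl
                    ; sym   = λ {a} {b} → ≡ₘ-sym {a} {b}
                    ; trans = λ {a} {b} {c} → ≡ₘ-trans {a} {b} {c}
                    }
                  ; ∙-cong = λ {a} {b} {c} {d} → +-congₘ {a} {b} {c} {d}
                  }
                ; assoc = λ a b c → ≡⇒≡ₘ (ℤₚ.+-assoc a b c)
                }
              ; identity = (λ a → ≡⇒≡ₘ (ℤₚ.+-identityˡ a)) , (λ a → ≡⇒≡ₘ (ℤₚ.+-identityʳ a))
              }
            ; inverse = (λ a → ≡⇒≡ₘ (ℤₚ.+-inverseˡ a)) , (λ a → ≡⇒≡ₘ (ℤₚ.+-inverseʳ a))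
            ; ⁻¹-cong = λ {a} {b} → -‿congₘ {a} {b}
            }
          ; comm = λ a b → ≡⇒≡ₘ (ℤₚ.+-comm a b)
          }
        ; *-cong = λ {a} {b} {c} {d} → *-congₘ {a} {b} {c} {d}
        ; *-assoc = λ a b c → ≡⇒≡ₘ (ℤₚ.*-assoc a b c)
        ; *-identity = (λ a → ≡⇒≡ₘ (ℤₚ.*-identityˡ a)) , (λ a → ≡⇒≡ₘ (ℤₚ.*-identityʳ a))
        ; distrib = (λ a b c → ≡⇒≡ₘ (ℤₚ.*-distribˡ-+ a b c)) , (λ a b c → ≡⇒≡ₘ (ℤₚ.*-distribʳ-+ a b c))
        }
      ; *-comm = λ a b → ≡⇒≡ₘ (ℤₚ.*-comm a b)
      }
    }

module ℤ[x] = Polynomial ℤₚ.+-*-commutativeRing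
module ℚ[x] = Polynomial ℚₚ.+-*-commutativeRing
module ℤ/[x] (m : ℕ) = Polynomial (ℤ/ m)

toℚ[x] : ℤ[x].Poly → ℚ[x].Poly
toℚ[x] = map fromℤ

-- Residue classes are represented by arbitrary integers, so reducing leaves
-- the list of representatives unchanged.
reduce : (m : ℕ) → ℤ[x].Poly → ℤ/[x].Poly m
reduce m f = f

Nonconstant : ℤ[x].Poly → Set
Nonconstant f = ∃[ n ] 1 ≤ n × ℤ[x].HasDegree f n

SeparableOverℚ : ℤ[x].Poly → Set
SeparableOverℚ f = ℚ[x].Separable (toℚ[x] f)

record Squarefree (d : ℤ) : Set where
  field
    nonZero    : ℤ.NonZero d
    squarefree : ∀ m → m ℤ.* m ∣ d → ∣ m ∣ ≡ 1

-- d = S(r), for r ≠ 0: d is squarefree and r/d is a square in ℚ.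
IsSquarefreePart : ℚ → ℤ → Set
IsSquarefreePart r d =
  Σ (Squarefree d) λ sf → ∃[ s ] (r ÷ fromℤ d) {{Squarefree.nonZero sf}} ≡ s ℚ.* s

infix 4 _∈𝒮_
_∈𝒮_ : ℤ → ℤ[x].Poly → Set
d ∈𝒮 f = ∃[ r ] (value r ≢ 0ℚ × IsSquarefreePart (value r) d)
  where
  value : ℚ → ℚ
  value = ℚ[x].eval (toℚ[x] f)

record Good (f : ℤ[x].Poly) (q : ℕ) : Set where
  open ℤ/[x] q using (HasDegree; IsDiscriminant)
  field
    isPrime    : Prime q
    odd        : q ≢ 2
    degree     : ℕ
    hasDegree  : ℤ[x].HasDegree f degree
    sameDegree : HasDegree (reduce q f) degree
    disc       : ℤ
    isDisc     : IsDiscriminant degree (reduce q f) disc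
    disc≢0     : ¬ (_≡ₘ_ q disc 0ℤ)

HasRootMod : ℤ[x].Poly → ℕ → Set
HasRootMod f q = ∃[ a ] _≡ₘ_ q (ℤ/[x].eval q (reduce q f) a) 0ℤ

infix 4 _∈R_
_∈R_ : ℕ → ℤ[x].Poly → Set
q ∈R f = Good f q × HasRootMod f q

-- No finite list exhausts P.
InfinitelyMany : (ℤ → Set) → Set
InfinitelyMany P = ∀ (ds : List ℤ) → ∃[ d ] (d ∉ ds × P d)

{-# OPTIONS --safe #-}

-- If q ∈ T divided both f(a) and f′(a), the Sylvester matrix of f and f′ modulo q
-- would kill the vector of powers of a, so the discriminant would vanish modulo q.
-- Hence roots modulo q ∈ T are simple, and either a or a + q is a point where the
-- value of f is divisible by q exactly once; this depends only on the point modulo q².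
-- Schur's argument gives a further prime p with the same property, not dividing any
-- nonzero member of a given finite list ds; here p is kept away from the finitely
-- many common divisors of f(n) and f′(n), which separability over ℚ provides.
-- The Chinese remainder theorem yields an integer n at which p and all q ∈ T divide
-- f(n) exactly once, so they all divide S(f(n)), and S(f(n)) ∉ ds because of p.

module Submission where

open import Defs
open import Algebra.Bundles using (CommutativeRing; Semiring)
import Algebra.Definitions.RawSemiring as RawSemiringDefs
import Algebra.Properties.Ring as RingProperties
import Algebra.Properties.Semiring.Sum as SumProperties
import Algebra.Solver.Ring.NaturalCoefficients.Default as SemiringSolver
open import Data.Empty using (⊥-elim)
open import Data.Fin.Base using (Fin; zero; suc; toℕ; fromℕ; inject₁; opposite; punchIn; punchOut; splitAt)
open import Data.Fin.Induction using (>-weakInduction)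
open import Data.Fin.Properties using (_≟_; suc-injective; toℕ-inject₁; toℕ-fromℕ; toℕ<n; punchIn-injective; punchInᵢ≢i; punchIn-punchOut)
open import Data.Integer.Base as ℤ using (ℤ; +_; ∣_∣; 0ℤ; 1ℤ)
open import Data.Integer.Divisibility.Signed as ℤᵈ using (_∣_; divides; ∣ᵤ⇒∣; ∣⇒∣ᵤ)
import Data.Integer.Properties as ℤₚ
open import Data.Integer.Solver using (module +-*-Solver)
open import Data.List.Base using (List; []; _∷_; map)
open import Data.List.Membership.Propositional using (_∈_; _∉_)
open import Data.List.Relation.Unary.All as All using (All; []; _∷_)
open import Data.List.Relation.Unary.Any using (here; there)
open import Data.Nat.Base as ℕ using (ℕ; zero; suc; z≤n; s≤s)
open import Data.Nat.Coprimality using (Coprime; coprime-Bézout)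
import Data.Nat.Divisibility as ℕᵈ
open import Data.Nat.GCD using (module Bézout)
open import Data.Nat.Induction using (<-wellFounded)
open import Data.Nat.ListAction using (product)
open import Data.Nat.Primality using (Prime; euclidsLemma; prime⇒irreducible; prime⇒nonZero; ¬prime[1])
open import Data.Nat.Primality.Factorisation using (factorise)
import Data.Nat.Properties as ℕₚ
open import Data.List.Membership.DecPropositional ℕₚ._≟_ using (_∈?_)
open import Data.Product.Base using (∃-syntax; _×_; _,_; proj₁; proj₂)
import Data.Rational.Base as ℚ
open import Data.Rational.Literals using (fromℤ)
import Data.Rational.Properties as ℚₚ
open import Data.Rational.Solver using () renaming (module +-*-Solver to ℚ-Solver)
import Data.Rational.Unnormalised.Base as ℚᵘ
import Data.Rational.Unnormalised.Properties as ℚᵘₚ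
open import Data.Sum.Base using (_⊎_; inj₁; inj₂; [_,_]′)
open import Function.Base using (_∘_; id)
open import Induction.WellFounded using (Acc; acc)
open import Relation.Binary.PropositionalEquality as ≡ using (_≡_; _≢_)
import Relation.Binary.Reasoning.Setoid as SetoidReasoning
open import Relation.Nullary.Decidable using (yes; no; _×-dec_)
open import Relation.Nullary.Negation using (¬_)

-- Adjacent columns and the deletion of one column.

-- Adjacent indices, the only ones on which column operations are performed.
infix 4 _⋖_
data _⋖_ : ∀ {n} → Fin n → Fin n → Set where
  0⋖1 : ∀ {n} → zero {suc n} ⋖ suc zero
  s⋖s : ∀ {n} {i j : Fin n} → i ⋖ j → suc i ⋖ suc j

inject₁⋖suc : ∀ {n} (i : Fin n) → inject₁ i ⋖ suc i
inject₁⋖suc zero    = 0⋖1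
inject₁⋖suc (suc i) = s⋖s (inject₁⋖suc i)

⋖⇒≢ : ∀ {n} {i j : Fin n} → i ⋖ j → i ≢ j
⋖⇒≢ (s⋖s i⋖j) eq = ⋖⇒≢ i⋖j (suc-injective eq)

toℕ-⋖ : ∀ {n} {i j : Fin n} → i ⋖ j → toℕ j ≡ suc (toℕ i)
toℕ-⋖ 0⋖1       = ≡.refl
toℕ-⋖ (s⋖s i⋖j) = ≡.cong suc (toℕ-⋖ i⋖j)

-- Deleting `i` or its neighbour `j` leaves the same list of columns, except that one place shows
-- `j` in the first case and `i` in the second. If these two columns are equal, so are the two
-- minors.
punchIn-⋖ : ∀ {n} {i j : Fin (suc n)} → i ⋖ j → ∀ k →
            punchIn i k ≡ punchIn j k ⊎ (punchIn i k ≡ j × punchIn j k ≡ i)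
punchIn-⋖ 0⋖1 zero    = inj₂ (≡.refl , ≡.refl)
punchIn-⋖ 0⋖1 (suc k) = inj₁ ≡.refl
punchIn-⋖ {suc _} (s⋖s i⋖j) zero    = inj₁ ≡.refl
punchIn-⋖ {suc _} (s⋖s i⋖j) (suc k) with punchIn-⋖ i⋖j k
... | inj₁ eq        = inj₁ (≡.cong suc eq)
... | inj₂ (e₁ , e₂) = inj₂ (≡.cong suc e₁ , ≡.cong suc e₂)

-- Nothing lies between `i` and `j`, so deleting a third index keeps them neighbours; this lets
-- `det-alternating` recurse into the other minors.
punchOut-⋖ : ∀ {n} {i j : Fin (suc n)} → i ⋖ j → ∀ k → k ≡ i ⊎ k ≡ j ⊎
             (∃[ i′ ] ∃[ j′ ] i′ ⋖ j′ × punchIn k i′ ≡ i × punchIn k j′ ≡ j)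
punchOut-⋖ 0⋖1 zero       = inj₁ ≡.refl
punchOut-⋖ 0⋖1 (suc zero) = inj₂ (inj₁ ≡.refl)
punchOut-⋖ {suc (suc n)} 0⋖1 (suc (suc k)) =
  inj₂ (inj₂ (zero , suc zero , 0⋖1 , ≡.refl , ≡.refl))
punchOut-⋖ (s⋖s i⋖j) zero = inj₂ (inj₂ (_ , _ , i⋖j , ≡.refl , ≡.refl))
punchOut-⋖ {suc n} (s⋖s i⋖j) (suc k) with punchOut-⋖ i⋖j k
... | inj₁ eq        = inj₁ (≡.cong suc eq)
... | inj₂ (inj₁ eq) = inj₂ (inj₁ (≡.cong suc eq))
... | inj₂ (inj₂ (i′ , j′ , i′⋖j′ , e₁ , e₂)) =
  inj₂ (inj₂ (suc i′ , suc j′ , s⋖s i′⋖j′ , ≡.cong suc e₁ , ≡.cong suc e₂))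

-- Evaluation and coefficient bounds over a commutative ring.

module Evaluation {c ℓ} (R : CommutativeRing c ℓ) where
  open CommutativeRing R hiding (zero)
  open Polynomial R
  open SemiringSolver commutativeSemiring using (solve; _:=_; _:+_; _:*_; con)
  open SetoidReasoning setoid

  eval-≈0 : ∀ p x → (∀ k → coeff p k ≈ 0#) → eval p x ≈ 0#
  eval-≈0 []      x p≈0 = refl
  eval-≈0 (a ∷ p) x p≈0 = begin
    a + x * eval p x ≈⟨ +-cong (p≈0 0) (*-congˡ (eval-≈0 p x (p≈0 ∘ suc))) ⟩
    0# + x * 0#      ≈⟨ trans (+-identityˡ _) (zeroʳ x) ⟩
    0#               ∎

  eval-congₚ : ∀ p q x → p ≈ₚ q → eval p x ≈ eval q x
  eval-congₚ []      q       x p≈q = sym (eval-≈0 q x (sym ∘ p≈q))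
  eval-congₚ (a ∷ p) []      x p≈q = eval-≈0 (a ∷ p) x p≈q
  eval-congₚ (a ∷ p) (b ∷ q) x p≈q =
    +-cong (p≈q 0) (*-congˡ (eval-congₚ p q x (p≈q ∘ suc)))

  eval-+ₚ : ∀ p q x → eval (p +ₚ q) x ≈ eval p x + eval q x
  eval-+ₚ []      q       x = sym (+-identityˡ _)
  eval-+ₚ (a ∷ p) []      x = sym (+-identityʳ _)
  eval-+ₚ (a ∷ p) (b ∷ q) x = trans (+-congˡ (*-congˡ (eval-+ₚ p q x)))
    (solve 5 (λ a b x P Q → (a :+ b) :+ x :* (P :+ Q) := (a :+ x :* P) :+ (b :+ x :* Q))
      refl a b x (eval p x) (eval q x))

  eval-map-* : ∀ a p x → eval (map (a *_) p) x ≈ a * eval p x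
  eval-map-* a []      x = sym (zeroʳ a)
  eval-map-* a (b ∷ p) x = trans (+-congˡ (*-congˡ (eval-map-* a p x)))
    (solve 4 (λ a b x P → a :* b :+ x :* (a :* P) := a :* (b :+ x :* P)) refl a b x (eval p x))

  eval-*ₚ : ∀ p q x → eval (p *ₚ q) x ≈ eval p x * eval q x
  eval-*ₚ []      q x = sym (zeroˡ _)
  eval-*ₚ (a ∷ p) q x = begin
    eval (map (a *_) q +ₚ (0# ∷ p *ₚ q)) x
      ≈⟨ eval-+ₚ (map (a *_) q) (0# ∷ p *ₚ q) x ⟩
    eval (map (a *_) q) x + (0# + x * eval (p *ₚ q) x)
      ≈⟨ +-cong (eval-map-* a q x) (+-congˡ (*-congˡ (eval-*ₚ p q x))) ⟩
    a * eval q x + (0# + x * (eval p x * eval q x))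
      ≈⟨ solve 4 (λ a x P Q → a :* Q :+ (con 0 :+ x :* (P :* Q)) := (a :+ x :* P) :* Q)
           refl a x (eval p x) (eval q x) ⟩
    (a + x * eval p x) * eval q x ∎

  eval-deriv-∷ : ∀ a p x → eval (deriv (a ∷ p)) x ≈ eval p x + x * eval (deriv p) x
  eval-deriv-∷ a p x = trans (eval-+ₚ p (0# ∷ deriv p) x) (+-congˡ (+-identityˡ _))

  eval-x^· : ∀ k p x → eval p x ≈ 0# → eval (x^ k · p) x ≈ 0#
  eval-x^· zero    p x px≈0 = px≈0
  eval-x^· (suc k) p x px≈0 =
    trans (+-identityˡ _) (trans (*-congˡ (eval-x^· k p x px≈0)) (zeroʳ x))

  coeff-x^· : ∀ k p m → (∀ j → m ℕ.≤ j → coeff p j ≈ 0#) →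
              ∀ j → k ℕ.+ m ℕ.≤ j → coeff (x^ k · p) j ≈ 0#
  coeff-x^· zero    p m p≈0 j       le       = p≈0 j le
  coeff-x^· (suc k) p m p≈0 (suc j) (s≤s le) = coeff-x^· k p m p≈0 j le

  coeff-+ₚ-≈0 : ∀ p q k → coeff p k ≈ 0# → coeff q k ≈ 0# → coeff (p +ₚ q) k ≈ 0#
  coeff-+ₚ-≈0 []      q       k       p≈0 q≈0 = q≈0
  coeff-+ₚ-≈0 (a ∷ p) []      k       p≈0 q≈0 = p≈0
  coeff-+ₚ-≈0 (a ∷ p) (b ∷ q) zero    p≈0 q≈0 = trans (+-cong p≈0 q≈0) (+-identityˡ 0#)
  coeff-+ₚ-≈0 (a ∷ p) (b ∷ q) (suc k) p≈0 q≈0 = coeff-+ₚ-≈0 p q k p≈0 q≈0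

  -- Stated index by index, this bounds the degree of the derivative over any ring, including `ℤ/ q`
  -- with `q` dividing the degree, where the actual degree drops below the formal one.
  coeff-deriv-≈0 : ∀ p k → coeff p (suc k) ≈ 0# → coeff (deriv p) k ≈ 0#
  coeff-deriv-≈0 []      k       p≈0 = refl
  coeff-deriv-≈0 (a ∷ p) zero    p≈0 = coeff-+ₚ-≈0 p _ 0 p≈0 refl
  coeff-deriv-≈0 (a ∷ p) (suc k) p≈0 = coeff-+ₚ-≈0 p _ (suc k) p≈0 (coeff-deriv-≈0 p k p≈0)

-- Determinants, column operations and resultants.

module Determinant {c ℓ} (R : CommutativeRing c ℓ) where
  open CommutativeRing R hiding (zero)
  open Polynomial R
  open Evaluation R
  open RingProperties ring using (-1*x≈-x)
  open RawSemiringDefs (Semiring.rawSemiring semiring) using (_^_; sum)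
  open SumProperties semiring using (sum-cong-≋; ∑-distrib-+; *-distribˡ-sum)
  open SemiringSolver commutativeSemiring using (solve; _:=_; _:+_; _:*_; con)
  open SetoidReasoning setoid

  minor : ∀ {n} → Matrix (suc n) → Fin (suc n) → Matrix n
  minor M j i k = M (suc i) (punchIn j k)

  laplaceTerm : ∀ {n} → Matrix (suc n) → Fin (suc n) → Carrier
  laplaceTerm M j = (- 1#) ^ toℕ j * (M zero j * det (minor M j))

  det-cong : ∀ {n} {M N : Matrix n} → (∀ i j → M i j ≈ N i j) → det M ≈ det N
  det-cong {zero}  M≈N = refl
  det-cong {suc n} M≈N = sum-cong-≋ λ j →
    *-congˡ {(- 1#) ^ toℕ j} (*-cong (M≈N zero j) (det-cong λ i k → M≈N (suc i) (punchIn j k)))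

  -- In the expansion along the first row, the term at `c` is linear through its entry, since its
  -- minor omits column `c`; every other term is linear through its minor, by induction.
  det-linear : ∀ {n} (M N P : Matrix n) (c : Fin n) (a : Carrier) →
               (∀ i → P i c ≈ M i c + a * N i c) →
               (∀ i j → j ≢ c → P i j ≈ M i j) →
               (∀ i j → j ≢ c → P i j ≈ N i j) →
               det P ≈ det M + a * det N
  det-linear {suc n} M N P c a P≈M+aN P≈M P≈N = begin
    sum (laplaceTerm P)
      ≈⟨ sum-cong-≋ term ⟩
    sum (λ j → laplaceTerm M j + a * laplaceTerm N j)
      ≈⟨ ∑-distrib-+ (laplaceTerm M) (λ j → a * laplaceTerm N j) ⟩
    sum (laplaceTerm M) + sum (λ j → a * laplaceTerm N j)
      ≈⟨ +-congˡ (sym (*-distribˡ-sum a (laplaceTerm N))) ⟩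
    sum (laplaceTerm M) + a * sum (laplaceTerm N) ∎
    where
    term : ∀ j → laplaceTerm P j ≈ laplaceTerm M j + a * laplaceTerm N j
    term j with j ≟ c
    ... | yes ≡.refl = begin
      s * (P zero j * det (minor P j))
        ≈⟨ *-congˡ (*-congʳ (P≈M+aN zero)) ⟩
      s * ((M zero j + a * N zero j) * det (minor P j))
        ≈⟨ solve 5 (λ s m a n d → s :* ((m :+ a :* n) :* d) := s :* (m :* d) :+ a :* (s :* (n :* d)))
             refl s (M zero j) a (N zero j) (det (minor P j)) ⟩
      s * (M zero j * det (minor P j)) + a * (s * (N zero j * det (minor P j)))
        ≈⟨ +-cong (*-congˡ (*-congˡ (det-cong λ i k → P≈M (suc i) _ (punchInᵢ≢i j k))))
                  (*-congˡ (*-congˡ (*-congˡ (det-cong λ i k → P≈N (suc i) _ (punchInᵢ≢i j k))))) ⟩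
      laplaceTerm M j + a * laplaceTerm N j ∎
      where s = (- 1#) ^ toℕ j
    ... | no j≢c = begin
      s * (P zero j * det (minor P j))
        ≈⟨ *-congˡ (*-congˡ (det-linear (minor M j) (minor N j) (minor P j) c′ a col
             (λ i k k≢c′ → P≈M (suc i) _ (away k k≢c′))
             (λ i k k≢c′ → P≈N (suc i) _ (away k k≢c′)))) ⟩
      s * (P zero j * (det (minor M j) + a * det (minor N j)))
        ≈⟨ solve 5 (λ s p m a n → s :* (p :* (m :+ a :* n)) := s :* (p :* m) :+ a :* (s :* (p :* n)))
             refl s (P zero j) (det (minor M j)) a (det (minor N j)) ⟩
      s * (P zero j * det (minor M j)) + a * (s * (P zero j * det (minor N j)))
        ≈⟨ +-cong (*-congˡ (*-congʳ (P≈M zero j j≢c)))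
                  (*-congˡ (*-congˡ (*-congʳ (P≈N zero j j≢c)))) ⟩
      laplaceTerm M j + a * laplaceTerm N j ∎
      where
      s = (- 1#) ^ toℕ j
      c′ = punchOut j≢c
      inc′ : punchIn j c′ ≡ c
      inc′ = punchIn-punchOut j≢c
      col : ∀ i → minor P j i c′ ≈ minor M j i c′ + a * minor N j i c′
      col i = ≡.subst (λ k → P (suc i) k ≈ M (suc i) k + a * N (suc i) k) (≡.sym inc′) (P≈M+aN (suc i))
      away : ∀ k → k ≢ c′ → punchIn j k ≢ c
      away k k≢c′ eq = k≢c′ (punchIn-injective j k c′ (≡.trans eq (≡.sym inc′)))

  sum-≈0 : ∀ {n} (f : Fin n → Carrier) → (∀ i → f i ≈ 0#) → sum f ≈ 0#
  sum-≈0 {zero}  f f≈0 = refl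
  sum-≈0 {suc n} f f≈0 = trans (+-cong (f≈0 zero) (sum-≈0 (f ∘ suc) (f≈0 ∘ suc))) (+-identityˡ 0#)

  sum-cancel : ∀ {n} {i j : Fin n} (f : Fin n → Carrier) → i ⋖ j → f i + f j ≈ 0# →
               (∀ k → k ≢ i → k ≢ j → f k ≈ 0#) → sum f ≈ 0#
  sum-cancel f 0⋖1 fi+fj≈0 f≈0 = begin
    f zero + (f (suc zero) + sum g) ≈⟨ sym (+-assoc _ _ _) ⟩
    (f zero + f (suc zero)) + sum g
      ≈⟨ +-cong fi+fj≈0 (sum-≈0 g λ k → f≈0 (suc (suc k)) (λ ()) (λ ())) ⟩
    0# + 0#                         ≈⟨ +-identityˡ 0# ⟩
    0#                              ∎
    where
    g : Fin _ → Carrier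
    g k = f (suc (suc k))
  sum-cancel f (s⋖s i⋖j) fi+fj≈0 f≈0 = begin
    f zero + sum (f ∘ suc)
      ≈⟨ +-cong (f≈0 zero (λ ()) (λ ())) (sum-cancel (f ∘ suc) i⋖j fi+fj≈0
           λ k k≢i k≢j → f≈0 (suc k) (k≢i ∘ suc-injective) (k≢j ∘ suc-injective)) ⟩
    0# + 0# ≈⟨ +-identityˡ 0# ⟩
    0#      ∎

  -1*x+x≈0 : ∀ x → x + - 1# * x ≈ 0#
  -1*x+x≈0 x = trans (+-congˡ (-1*x≈-x x)) (-‿inverseʳ x)

  -- The terms at `i` and `j` have equal entries, equal minors and opposite signs. In every other
  -- term the two equal columns are still adjacent in the minor, which vanishes by induction.
  det-alternating : ∀ {n} (M : Matrix n) {i j : Fin n} → i ⋖ j →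
                    (∀ r → M r i ≈ M r j) → det M ≈ 0#
  det-alternating {suc n} M {i} {j} i⋖j Mᵢ≈Mⱼ = sum-cancel (laplaceTerm M) i⋖j cancel others
    where
    minors : ∀ r k → minor M j r k ≈ minor M i r k
    minors r k with punchIn-⋖ i⋖j k
    ... | inj₁ eq        = reflexive (≡.cong (M (suc r)) (≡.sym eq))
    ... | inj₂ (e₁ , e₂) = trans (reflexive (≡.cong (M (suc r)) e₂))
                             (trans (Mᵢ≈Mⱼ (suc r)) (reflexive (≡.cong (M (suc r)) (≡.sym e₁))))

    cancel : laplaceTerm M i + laplaceTerm M j ≈ 0#
    cancel = begin
      s * x + (- 1#) ^ toℕ j * (M zero j * det (minor M j))
        ≈⟨ +-congˡ (*-cong (reflexive (≡.cong ((- 1#) ^_) (toℕ-⋖ i⋖j)))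
                           (*-cong (sym (Mᵢ≈Mⱼ zero)) (det-cong minors))) ⟩
      s * x + (- 1# * s) * x ≈⟨ +-congˡ (*-assoc _ _ _) ⟩
      s * x + - 1# * (s * x) ≈⟨ -1*x+x≈0 (s * x) ⟩
      0# ∎
      where
      s = (- 1#) ^ toℕ i
      x = M zero i * det (minor M i)

    others : ∀ k → k ≢ i → k ≢ j → laplaceTerm M k ≈ 0#
    others k k≢i k≢j with punchOut-⋖ i⋖j k
    ... | inj₁ k≡i        = ⊥-elim (k≢i k≡i)
    ... | inj₂ (inj₁ k≡j) = ⊥-elim (k≢j k≡j)
    ... | inj₂ (inj₂ (i′ , j′ , i′⋖j′ , e₁ , e₂)) = begin
      s * (M zero k * det (minor M k))
        ≈⟨ *-congˡ (*-congˡ (det-alternating (minor M k) i′⋖j′ λ r →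
             ≡.subst₂ (λ u v → M (suc r) u ≈ M (suc r) v) (≡.sym e₁) (≡.sym e₂) (Mᵢ≈Mⱼ (suc r)))) ⟩
      s * (M zero k * 0#) ≈⟨ trans (*-congˡ (zeroʳ _)) (zeroʳ s) ⟩
      0# ∎
      where s = (- 1#) ^ toℕ k

  -- A zero column equals itself minus itself, so linearity gives `det M` minus `det M`.
  det-zeroColumn : ∀ {n} (M : Matrix n) (c : Fin n) → (∀ r → M r c ≈ 0#) → det M ≈ 0#
  det-zeroColumn M c M≈0 = trans
    (det-linear M M M c (- 1#) (λ r → trans (M≈0 r) (sym (-1*x+x≈0 (M r c))))
      (λ _ _ _ → refl) (λ _ _ _ → refl))
    (-1*x+x≈0 (det M))

  addColumn : ∀ {n} → Carrier → Fin n → Fin n → (Fin n → Carrier) → Fin n → Carrier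
  addColumn a i j r k with k ≟ j
  ... | yes _ = r k + a * r i
  ... | no  _ = r k

  addColumn-at : ∀ {n} a i (j : Fin n) r → addColumn a i j r j ≡ r j + a * r i
  addColumn-at a i j r with j ≟ j
  ... | yes _   = ≡.refl
  ... | no  j≢j = ⊥-elim (j≢j ≡.refl)

  addColumn-away : ∀ {n} a i (j : Fin n) r k → k ≢ j → addColumn a i j r k ≡ r k
  addColumn-away a i j r k k≢j with k ≟ j
  ... | yes k≡j = ⊥-elim (k≢j k≡j)
  ... | no  _   = ≡.refl

  replaceColumn : ∀ {n} → Fin n → Fin n → (Fin n → Carrier) → Fin n → Carrier
  replaceColumn i j r k with k ≟ j
  ... | yes _ = r i
  ... | no  _ = r k

  replaceColumn-at : ∀ {n} i (j : Fin n) r → replaceColumn i j r j ≡ r i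
  replaceColumn-at i j r with j ≟ j
  ... | yes _   = ≡.refl
  ... | no  j≢j = ⊥-elim (j≢j ≡.refl)

  replaceColumn-away : ∀ {n} i (j : Fin n) r k → k ≢ j → replaceColumn i j r k ≡ r k
  replaceColumn-away i j r k k≢j with k ≟ j
  ... | yes k≡j = ⊥-elim (k≢j k≡j)
  ... | no  _   = ≡.refl

  -- By linearity the change is `a` times the determinant of `N`, in which column `j` is overwritten
  -- by its neighbour `i`.
  det-addColumn : ∀ {n} (M : Matrix n) a {i j : Fin n} → i ⋖ j →
                  det (addColumn a i j ∘ M) ≈ det M
  det-addColumn M a {i} {j} i⋖j = begin
    det (addColumn a i j ∘ M)
      ≈⟨ det-linear M N (addColumn a i j ∘ M) j a
           (λ r → reflexive (≡.trans (addColumn-at a i j (M r))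
              (≡.cong (λ y → M r j + a * y) (≡.sym (replaceColumn-at i j (M r))))))
           (λ r k k≢j → reflexive (addColumn-away a i j (M r) k k≢j))
           (λ r k k≢j → reflexive (≡.trans (addColumn-away a i j (M r) k k≢j)
              (≡.sym (replaceColumn-away i j (M r) k k≢j)))) ⟩
    det M + a * det N
      ≈⟨ +-congˡ (*-congˡ (det-alternating N i⋖j λ r → reflexive
           (≡.trans (replaceColumn-away i j (M r) i (⋖⇒≢ i⋖j))
             (≡.sym (replaceColumn-at i j (M r)))))) ⟩
    det M + a * 0# ≈⟨ trans (+-congˡ (zeroʳ a)) (+-identityʳ _) ⟩
    det M ∎
    where
    N : Matrix _
    N = replaceColumn i j ∘ M

  module _ (a : Carrier) where

    -- The accumulator is `s`; entries are coefficients from the highest power down, the column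
    -- order of `sylvester`.
    horner : ∀ {n} → Carrier → (Fin n → Carrier) → Carrier
    horner {zero}  s r = s
    horner {suc n} s r = horner (s * a + r zero) (r ∘ suc)

    -- The scheme restarted at column `t`: after the column operations, the contribution of the
    -- earlier entries is contained in entry `t`.
    hornerFrom : ∀ {n} → Fin n → (Fin n → Carrier) → Carrier
    hornerFrom zero    r = horner 0# r
    hornerFrom (suc t) r = hornerFrom t (r ∘ suc)

    horner-cong : ∀ {n} {s s′} {r r′ : Fin n → Carrier} →
                  s ≈ s′ → (∀ j → r j ≈ r′ j) → horner s r ≈ horner s′ r′
    horner-cong {zero}  s≈ r≈ = s≈
    horner-cong {suc n} s≈ r≈ = horner-cong (+-cong (*-congʳ s≈) (r≈ zero)) (r≈ ∘ suc)

    hornerFrom-last : ∀ n (r : Fin (suc n) → Carrier) → hornerFrom (fromℕ n) r ≈ r (fromℕ n)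
    hornerFrom-last zero    r = trans (+-congʳ (zeroˡ a)) (+-identityˡ _)
    hornerFrom-last (suc n) r = hornerFrom-last n (r ∘ suc)

    -- Adding `a` times an entry to its successor is one Horner step carried out in place.
    hornerFrom-step : ∀ {n} {i j : Fin n} → i ⋖ j → (r r′ : Fin n → Carrier) →
                      r′ j ≈ r j + a * r i → (∀ k → k ≢ j → r′ k ≈ r k) →
                      hornerFrom j r′ ≈ hornerFrom i r
    hornerFrom-step 0⋖1 r r′ at away = horner-cong
      (trans (+-congˡ at) (solve 3 (λ a x y → con 0 :* a :+ (y :+ a :* x) := (con 0 :* a :+ x) :* a :+ y)
        refl a (r zero) (r (suc zero))))
      (λ k → away (suc (suc k)) λ ())
    hornerFrom-step (s⋖s i⋖j) r r′ at away =
      hornerFrom-step i⋖j (r ∘ suc) (r′ ∘ suc) at (λ k k≢j → away (suc k) (k≢j ∘ suc-injective))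

    -- Horner's scheme, run on all rows at once, consists of adjacent column
    -- operations and ends with the values of the rows at a in the last column.
    det-hornerFrom : ∀ {n} (t : Fin n) (M : Matrix n) →
                     (∀ r → hornerFrom t (M r) ≈ 0#) → det M ≈ 0#
    det-hornerFrom {suc n} = >-weakInduction
      (λ t → (M : Matrix (suc n)) → (∀ r → hornerFrom t (M r) ≈ 0#) → det M ≈ 0#)
      (λ M M≈0 → det-zeroColumn M (fromℕ n) λ r →
        trans (sym (hornerFrom-last n (M r))) (M≈0 r))
      (λ t ih M M≈0 → trans (sym (det-addColumn M a (inject₁⋖suc t)))
        (ih (addColumn a (inject₁ t) (suc t) ∘ M) λ r → trans
          (hornerFrom-step (inject₁⋖suc t) (M r) _
            (reflexive (addColumn-at a (inject₁ t) (suc t) (M r)))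
            (λ k k≢ → reflexive (addColumn-away a (inject₁ t) (suc t) (M r) k k≢)))
          (M≈0 r)))

    -- Coefficients are taken by exponent, from `n - 1` down to `0`. This form removes the reversal
    -- `opposite` and can be compared with `eval`.
    hornerℕ : ℕ → Carrier → (ℕ → Carrier) → Carrier
    hornerℕ zero    s g = s
    hornerℕ (suc n) s g = hornerℕ n (s * a + g n) g

    horner-opposite : ∀ n s g → horner s (λ (j : Fin n) → g (toℕ (opposite j))) ≈ hornerℕ n s g
    horner-opposite zero    s g = refl
    horner-opposite (suc n) s g = trans
      (horner-cong {n} (+-congˡ {s * a} (reflexive (≡.cong g (toℕ-fromℕ n))))
                   (λ j → reflexive (≡.cong g (toℕ-inject₁ (opposite j)))))
      (horner-opposite n (s * a + g n) g)

    hornerℕ-∷ : ∀ n s b p → hornerℕ (suc n) s (coeff (b ∷ p)) ≈ b + a * hornerℕ n s (coeff p)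
    hornerℕ-∷ zero    s b p = trans (+-comm _ _) (+-congˡ (*-comm s a))
    hornerℕ-∷ (suc n) s b p = hornerℕ-∷ n (s * a + coeff p n) b p

    hornerℕ-[] : ∀ n s → s ≈ 0# → hornerℕ n s (coeff []) ≈ 0#
    hornerℕ-[] zero    s s≈0 = s≈0
    hornerℕ-[] (suc n) s s≈0 = hornerℕ-[] n _
      (trans (+-identityʳ _) (trans (*-congʳ s≈0) (zeroˡ a)))

    hornerℕ-eval : ∀ n p → (∀ k → n ℕ.≤ k → coeff p k ≈ 0#) →
                   hornerℕ n 0# (coeff p) ≈ eval p a
    hornerℕ-eval n       []      p≈0 = hornerℕ-[] n 0# refl
    hornerℕ-eval zero    (b ∷ p) p≈0 = sym (eval-≈0 (b ∷ p) a λ k → p≈0 k z≤n)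
    hornerℕ-eval (suc n) (b ∷ p) p≈0 = trans (hornerℕ-∷ n 0# b p)
      (+-congˡ (*-congˡ (hornerℕ-eval n p λ k n≤k → p≈0 (suc k) (s≤s n≤k))))

    -- Each row lists the coefficients of a power of `x` times `p` or `q`, a polynomial that fits
    -- into the columns and vanishes at `a`. The index `t` says that the matrix is nonempty: the
    -- empty determinant is `1`.
    resultant-commonRoot : ∀ m n p q → Fin (n ℕ.+ m) →
      (∀ k → m ℕ.< k → coeff p k ≈ 0#) → (∀ k → n ℕ.< k → coeff q k ≈ 0#) →
      eval p a ≈ 0# → eval q a ≈ 0# → resultant m n p q ≈ 0#
    resultant-commonRoot m n p q t p≈0 q≈0 pa≈0 qa≈0 = det-horner t (sylvester m n p q) row
      where
      det-horner : ∀ {N} → Fin N → (M : Matrix N) → (∀ i → horner 0# (M i) ≈ 0#) → det M ≈ 0#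
      det-horner {suc N} _ = det-hornerFrom zero

      value : ∀ {N} u → (∀ k → N ℕ.≤ k → coeff u k ≈ 0#) → eval u a ≈ 0# →
              horner 0# (λ (j : Fin N) → coeff u (toℕ (opposite j))) ≈ 0#
      value {N} u u≈0 ua≈0 =
        trans (horner-opposite N 0# (coeff u)) (trans (hornerℕ-eval N u u≈0) ua≈0)

      bound : ∀ {N d} (k : Fin N) → toℕ k ℕ.+ suc d ℕ.≤ N ℕ.+ d
      bound {N} {d} k = ℕₚ.≤-trans (ℕₚ.≤-reflexive (ℕₚ.+-suc (toℕ k) d)) (ℕₚ.+-monoˡ-≤ d (toℕ<n k))

      row : ∀ i → horner 0# (sylvester m n p q i) ≈ 0#
      row i with splitAt n i
      ... | inj₁ k = value (x^ toℕ (opposite k) · p)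
        (λ j le → coeff-x^· (toℕ (opposite k)) p (suc m) p≈0 j (ℕₚ.≤-trans (bound (opposite k)) le))
        (eval-x^· (toℕ (opposite k)) p a pa≈0)
      ... | inj₂ k = value (x^ toℕ (opposite k) · q)
        (λ j le → coeff-x^· (toℕ (opposite k)) q (suc n) q≈0 j
          (ℕₚ.≤-trans (ℕₚ.≤-trans (bound (opposite k)) (ℕₚ.≤-reflexive (ℕₚ.+-comm m n))) le))
        (eval-x^· (toℕ (opposite k)) q a qa≈0)

-- Rational identities for clearing denominators.

module _ where
  open ℚ-Solver

  rearrange-∷ : ∀ d c a x u → (d ℚ.* c) ℚ.* (a ℚ.+ x ℚ.* u) ≡ c ℚ.* (d ℚ.* a) ℚ.+ d ℚ.* (x ℚ.* (c ℚ.* u))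
  rearrange-∷ = solve 5 (λ d c a x u →
    (d :* c) :* (a :+ x :* u) := c :* (d :* a) :+ d :* (x :* (c :* u))) ≡.refl

  rearrange-bezout : ∀ c₁ c₂ u v y z → c₁ ℚ.* c₂ ℚ.* (u ℚ.* y ℚ.+ v ℚ.* z) ≡
                     c₂ ℚ.* (c₁ ℚ.* u) ℚ.* y ℚ.+ c₁ ℚ.* (c₂ ℚ.* v) ℚ.* z
  rearrange-bezout = solve 6 (λ c₁ c₂ u v y z →
    c₁ :* c₂ :* (u :* y :+ v :* z) := c₂ :* (c₁ :* u) :* y :+ c₁ :* (c₂ :* v) :* z) ≡.refl

-- Integer polynomials and divisibility by primes.

open import Data.Integer.Base using (_+_; _*_; -_; _-_)
open +-*-Solver using (solve; _:=_; _:+_; _:*_; _:-_; :-_; con)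

eval : ℤ[x].Poly → ℤ → ℤ
eval = ℤ[x].eval

eval′ : ℤ[x].Poly → ℤ → ℤ
eval′ f = eval (ℤ[x].deriv f)

SimpleRoot : ℤ[x].Poly → ℕ → ℤ → Set
SimpleRoot f q a = + q ∣ eval f a × ¬ (+ q ∣ eval′ f a)

prime-∣* : ∀ {p} → Prime p → ∀ a b → + p ∣ a * b → (+ p ∣ a) ⊎ (+ p ∣ b)
prime-∣* {p} pp a b p∣ab =
  [ inj₁ ∘ ∣ᵤ⇒∣ , inj₂ ∘ ∣ᵤ⇒∣ ]′
    (euclidsLemma ∣ a ∣ ∣ b ∣ pp (≡.subst (p ℕᵈ.∣_) (ℤₚ.abs-* a b) (∣⇒∣ᵤ p∣ab)))

prime∤1 : ∀ {p} → Prime p → ¬ (+ p ∣ 1ℤ)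
prime∤1 pp p∣1 = ¬prime[1] (≡.subst Prime (ℕᵈ.∣1⇒≡1 (∣⇒∣ᵤ p∣1)) pp)

-- Good primes have simple roots

-- `ℤ/ q` has the carrier and operations of `ℤ` and differs only in its equality, so the two values
-- are the same integer and congruences become divisibilities.
eval-ℤ/ : ∀ q f a → ℤ/[x].eval q f a ≡ eval f a
eval-ℤ/ q []      a = ≡.refl
eval-ℤ/ q (c ∷ f) a = ≡.cong (λ y → c + a * y) (eval-ℤ/ q f a)

+ₚ-ℤ/ : ∀ q f g → ℤ/[x]._+ₚ_ q f g ≡ ℤ[x]._+ₚ_ f g
+ₚ-ℤ/ q []      g       = ≡.refl
+ₚ-ℤ/ q (c ∷ f) []      = ≡.refl
+ₚ-ℤ/ q (c ∷ f) (d ∷ g) = ≡.cong (c + d ∷_) (+ₚ-ℤ/ q f g)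

deriv-ℤ/ : ∀ q f → ℤ/[x].deriv q f ≡ ℤ[x].deriv f
deriv-ℤ/ q []      = ≡.refl
deriv-ℤ/ q (c ∷ f) = ≡.trans (+ₚ-ℤ/ q f _) (≡.cong (λ g → ℤ[x]._+ₚ_ f (0ℤ ∷ g)) (deriv-ℤ/ q f))

∣⇒≡ₘ0 : ∀ {q a} → + q ∣ a → _≡ₘ_ q a 0ℤ
∣⇒≡ₘ0 {q} {a} = ≡.subst (+ q ∣_) (≡.sym (ℤₚ.+-identityʳ a))

≡ₘ0⇒∣ : ∀ {q a} → _≡ₘ_ q a 0ℤ → + q ∣ a
≡ₘ0⇒∣ {q} {a} = ≡.subst (+ q ∣_) (ℤₚ.+-identityʳ a)

-- A common root of `f` and its derivative modulo `q` makes the resultant vanish, hence also the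
-- leading coefficient times the discriminant; goodness excludes `q` from both factors.
∈R⇒simpleRoot : ∀ {f q} → Nonconstant f → q ∈R f → Prime q × ∃[ a ] SimpleRoot f q a
∈R⇒simpleRoot {f} {q} (n , 1≤n , fₙ≢0 , _) (good , a , fa≡0) =
  isPrime , a , ≡.subst (+ q ∣_) (eval-ℤ/ q f a) (≡ₘ0⇒∣ fa≡0) , simple degree ≡.refl
  where
  open Good good
  open ℤ/[x] q using (coeff; resultant; deriv)
  open RawSemiringDefs (Semiring.rawSemiring (CommutativeRing.semiring (ℤ/ q))) using (_^_)

  simple : ∀ d → d ≡ degree → ¬ (+ q ∣ eval′ f a)
  -- Degree `0` would make the coefficient at `n` vanish, as `1 ≤ n`.
  simple zero    ≡.refl _     = fₙ≢0 (proj₂ hasDegree n 1≤n)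
  simple (suc d) ≡.refl q∣f′a =
    [ (λ q∣c → proj₁ sameDegree (∣⇒≡ₘ0 {q} {lead} q∣c)) , (λ q∣D → disc≢0 (∣⇒≡ₘ0 {q} {disc} q∣D)) ]′
      (prime-∣* isPrime lead disc
        (ℤᵈ.∣m+n∣n⇒∣m {m = lead * disc} isDisc
          (ℤᵈ.∣m⇒∣-m (ℤᵈ.∣n⇒∣m*n (ℤ.-1ℤ ^ ℕ.⌊ suc d ℕ.* d /2⌋) (≡ₘ0⇒∣ {q} {resultant (suc d) d f (deriv f)} res≈0)))))
    where
    lead = coeff f (suc d)
    f′a≡0 : _≡ₘ_ q (ℤ/[x].eval q (deriv f) a) 0ℤ
    f′a≡0 = ∣⇒≡ₘ0 {q} {ℤ/[x].eval q (deriv f) a} (≡.subst (+ q ∣_)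
      (≡.trans (≡.cong (λ g → eval g a) (≡.sym (deriv-ℤ/ q f))) (≡.sym (eval-ℤ/ q (deriv f) a))) q∣f′a)
    res≈0 : _≡ₘ_ q (resultant (suc d) d f (deriv f)) 0ℤ
    res≈0 = Determinant.resultant-commonRoot (ℤ/ q) a (suc d) d f (deriv f)
      (≡.subst Fin (≡.sym (ℕₚ.+-suc d d)) zero)
      (proj₂ sameDegree)
      (λ k d<k → Evaluation.coeff-deriv-≈0 (ℤ/ q) f k (proj₂ sameDegree (suc k) (s≤s d<k)))
      fa≡0 f′a≡0

-- Exact divisibility by a prime at prescribed points

-- The second-order remainder is built along the coefficient list. One factor `y` stays outside so
-- that `lift-simpleRoot` can cancel it.
taylor : ∀ f a y → ∃[ w ] eval f (a + y) ≡ eval f a + y * (eval′ f a + y * w)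
taylor []      a y = 0ℤ , solve 1 (λ y → con 0ℤ := con 0ℤ :+ y :* (con 0ℤ :+ y :* con 0ℤ)) ≡.refl y
taylor (c ∷ f) a y with taylor f a y
... | w , eq = eval′ f a + (a + y) * w , (begin
  c + (a + y) * eval f (a + y)
    ≡⟨ ≡.cong (λ z → c + (a + y) * z) eq ⟩
  c + (a + y) * (F + y * (F′ + y * w))
    ≡⟨ solve 6 (λ c a y F F′ w →
         c :+ (a :+ y) :* (F :+ y :* (F′ :+ y :* w)) :=
         (c :+ a :* F) :+ y :* ((F :+ a :* F′) :+ y :* (F′ :+ (a :+ y) :* w)))
         ≡.refl c a y F F′ w ⟩
  (c + a * F) + y * ((F + a * F′) + y * (F′ + (a + y) * w))
    ≡⟨ ≡.cong (λ z → (c + a * F) + y * (z + y * (F′ + (a + y) * w)))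
         (Evaluation.eval-deriv-∷ ℤₚ.+-*-commutativeRing c f a) ⟨
  (c + a * F) + y * (eval′ (c ∷ f) a + y * (F′ + (a + y) * w)) ∎)
  where
  open ≡.≡-Reasoning
  F = eval f a
  F′ = eval′ f a

eval-congruence : ∀ f a y → ∃[ w ] eval f (a + y) ≡ eval f a + y * w
eval-congruence f a y with taylor f a y
... | w , eq = _ , eq

ExactlyDivides : ℕ → ℤ → Set
ExactlyDivides q z = + q ∣ z × ¬ (+ q * + q ∣ z)

-- Modulo the square of `q`, passing from `a` to `a + q` changes the value by `q` times the
-- derivative at `a`. This change is nonzero there, so the square cannot divide both values.
lift-simpleRoot : ∀ {f q a} → Prime q → SimpleRoot f q a → ∃[ b ] ExactlyDivides q (eval f b)
lift-simpleRoot {f} {q} {a} pq (q∣fa , q∤f′a) with (+ q * + q) ℤᵈ.∣? eval f a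
... | no  q²∤fa = a , q∣fa , q²∤fa
... | yes q²∣fa with taylor f a (+ q)
...   | w , eq = a + + q ,
  ≡.subst (+ q ∣_) (≡.sym eq) (ℤᵈ.∣m∣n⇒∣m+n q∣fa (ℤᵈ.∣m⇒∣m*n _ ℤᵈ.∣-refl)) ,
  λ q²∣f → q∤f′a (ℤᵈ.∣m+n∣n⇒∣m {+ q} {eval′ f a}
    (ℤᵈ.*-cancelˡ-∣ (+ q) {{prime⇒nonZero pq}}
      (ℤᵈ.∣m+n∣m⇒∣n (≡.subst (+ q * + q ∣_) eq q²∣f) q²∣fa))
    (ℤᵈ.∣m⇒∣m*n w ℤᵈ.∣-refl))

ExactlyDivides-shift : ∀ f q a y → + q * + q ∣ y →
                       ExactlyDivides q (eval f a) → ExactlyDivides q (eval f (a + y))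
ExactlyDivides-shift f q a y q²∣y (q∣fa , q²∤fa) with eval-congruence f a y
... | w , eq =
  ≡.subst (+ q ∣_) (≡.sym eq) (ℤᵈ.∣m∣n⇒∣m+n q∣fa (ℤᵈ.∣-trans (ℤᵈ.∣m⇒∣m*n (+ q) ℤᵈ.∣-refl) q²∣yw)) ,
  λ q²∣f → q²∤fa (ℤᵈ.∣m+n∣n⇒∣m (≡.subst (+ q * + q ∣_) eq q²∣f) q²∣yw)
  where
  q²∣yw : + q * + q ∣ y * w
  q²∣yw = ℤᵈ.∣m⇒∣m*n w q²∣y

prime-inverse : ∀ {q} → Prime q → ∀ m → ¬ (q ℕᵈ.∣ m) → ∃[ s ] ∃[ r ] s * + m ≡ 1ℤ + r * + q
prime-inverse {q} pq m q∤m with coprime-Bézout {m} {q} coprime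
  where
  coprime : Coprime m q
  coprime (i∣m , i∣q) with prime⇒irreducible pq i∣q
  ... | inj₁ i≡1    = i≡1
  ... | inj₂ ≡.refl = ⊥-elim (q∤m i∣m)
... | Bézout.+- x y eq = + x , + y , (begin
  + x * + m       ≡⟨ ℤₚ.pos-* x m ⟨
  + (x ℕ.* m)     ≡⟨ ≡.cong +_ eq ⟨
  1ℤ + + (y ℕ.* q) ≡⟨ ≡.cong (λ z → 1ℤ + z) (ℤₚ.pos-* y q) ⟩
  1ℤ + + y * + q  ∎)
  where open ≡.≡-Reasoning
-- Here `1 + x m = y q`, so both coefficients change sign.
... | Bézout.-+ x y eq = - (+ x) , - (+ y) , (begin
  - (+ x) * + m
    ≡⟨ solve 2 (λ x m → :- x :* m := con 1ℤ :- (con 1ℤ :+ x :* m)) ≡.refl (+ x) (+ m) ⟩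
  1ℤ - (1ℤ + + x * + m) ≡⟨ ≡.cong (λ z → 1ℤ - (1ℤ + z)) (ℤₚ.pos-* x m) ⟨
  1ℤ - (+ (1 ℕ.+ x ℕ.* m)) ≡⟨ ≡.cong (λ z → 1ℤ - + z) eq ⟩
  1ℤ - + (y ℕ.* q) ≡⟨ ≡.cong (λ z → 1ℤ - z) (ℤₚ.pos-* y q) ⟩
  1ℤ - + y * + q
    ≡⟨ solve 2 (λ y q → con 1ℤ :- y :* q := con 1ℤ :+ (:- y) :* q) ≡.refl (+ y) (+ q) ⟩
  1ℤ + - (+ y) * + q ∎)
  where open ≡.≡-Reasoning

-- If s m = 1 + r q then s m (1 - r q) = 1 - r²q², so m is invertible modulo q².
crt-step : ∀ {q} → Prime q → ∀ m → ¬ (q ℕᵈ.∣ m) → ∀ a b →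
           ∃[ t ] ∃[ z ] b + + m * t ≡ a + (+ q * + q) * z
crt-step {q} pq m q∤m a b with prime-inverse pq m q∤m
... | s , r , eq = s * (1ℤ - r * + q) * (a - b) , - (r * r) * (a - b) , (begin
  b + + m * (s * (1ℤ - r * + q) * (a - b))
    ≡⟨ solve 6 (λ a b m s r q → b :+ m :* (s :* (con 1ℤ :- r :* q) :* (a :- b)) :=
                               b :+ (s :* m) :* ((con 1ℤ :- r :* q) :* (a :- b)))
         ≡.refl a b (+ m) s r (+ q) ⟩
  b + (s * + m) * ((1ℤ - r * + q) * (a - b))
    ≡⟨ ≡.cong (λ z → b + z * ((1ℤ - r * + q) * (a - b))) eq ⟩
  b + (1ℤ + r * + q) * ((1ℤ - r * + q) * (a - b))
    ≡⟨ solve 4 (λ a b r q → b :+ (con 1ℤ :+ r :* q) :* ((con 1ℤ :- r :* q) :* (a :- b)) :=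
                           a :+ (q :* q) :* (:- (r :* r) :* (a :- b)))
         ≡.refl a b r (+ q) ⟩
  a + (+ q * + q) * (- (r * r) * (a - b)) ∎)
  where open ≡.≡-Reasoning

-- The modulus `m` carries the square of `q`, so moving `n` by a multiple of `m` preserves
-- exactness.
ExactAt : ℤ[x].Poly → ℤ → ℕ → ℕ → Set
ExactAt f n m q = ExactlyDivides q (eval f n) × + q * + q ∣ + m

prime-∣-prime : ∀ {p q} → Prime p → Prime q → p ℕᵈ.∣ q → p ≡ q
prime-∣-prime pp pq p∣q with prime⇒irreducible pq p∣q
... | inj₁ ≡.refl = ⊥-elim (¬prime[1] pp)
... | inj₂ p≡q    = p≡q

-- The Chinese remainder theorem, one prime at a time. The condition on the prime divisors of `m` is
-- the invariant that keeps a prime outside the treated list from dividing `m`, as `crt-step`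
-- requires.
simultaneous : ∀ f T → All (λ q → Prime q × ∃[ a ] ExactlyDivides q (eval f a)) T →
  ∃[ n ] ∃[ m ] All (ExactAt f n m) T × (∀ {p} → Prime p → p ℕᵈ.∣ m → p ∈ T)
simultaneous f [] [] = 0ℤ , 1 , [] , λ pp p∣1 → ⊥-elim (prime∤1 pp (∣ᵤ⇒∣ p∣1))
simultaneous f (q ∷ T) ((pq , a , exact) ∷ rest) = extend (simultaneous f T rest)
  where
  extend : ∃[ n ] ∃[ m ] All (ExactAt f n m) T × (∀ {p} → Prime p → p ℕᵈ.∣ m → p ∈ T) →
    ∃[ n ] ∃[ m ] All (ExactAt f n m) (q ∷ T) × (∀ {p} → Prime p → p ℕᵈ.∣ m → p ∈ q ∷ T)
  extend (n , m , all , support) with q ∈? T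
  -- A repeated prime inherits exactness at `n` from its earlier treatment.
  ... | yes q∈T = n , m , All.lookup all q∈T ∷ all , λ pp p∣m → there (support pp p∣m)
  ... | no  q∉T = add (crt-step pq m (q∉T ∘ support pq) a n)
    where
    m′ = q ℕ.* q ℕ.* m

    m′≡ : + m′ ≡ + q * + q * + m
    m′≡ = ≡.trans (ℤₚ.pos-* (q ℕ.* q) m) (≡.cong (_* + m) (ℤₚ.pos-* q q))

    support′ : ∀ {p} → Prime p → p ℕᵈ.∣ m′ → p ∈ q ∷ T
    support′ pp p∣m′ with euclidsLemma (q ℕ.* q) m pp p∣m′
    ... | inj₂ p∣m  = there (support pp p∣m)
    ... | inj₁ p∣q² =
      here ([ prime-∣-prime pp pq , prime-∣-prime pp pq ]′ (euclidsLemma q q pp p∣q²))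

    add : ∃[ t ] ∃[ z ] n + + m * t ≡ a + (+ q * + q) * z →
      ∃[ n ] ∃[ m ] All (ExactAt f n m) (q ∷ T) × (∀ {p} → Prime p → p ℕᵈ.∣ m → p ∈ q ∷ T)
    add (t , z , eq) = n′ , m′ , new ∷ All.map old all , support′
      where
      n′ = n + + m * t

      new : ExactAt f n′ m′ q
      new = ≡.subst (λ x → ExactlyDivides q (eval f x)) (≡.sym eq)
              (ExactlyDivides-shift f q a (+ q * + q * z) (ℤᵈ.∣m⇒∣m*n {+ q * + q} {+ q * + q} z ℤᵈ.∣-refl) exact)
          , ≡.subst (+ q * + q ∣_) (≡.sym m′≡) (ℤᵈ.∣m⇒∣m*n {+ q * + q} {+ q * + q} (+ m) ℤᵈ.∣-refl)

      old : ∀ {p} → ExactAt f n m p → ExactAt f n′ m′ p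
      old {p} (exactₚ , p²∣m) =
          ExactlyDivides-shift f p n (+ m * t) (ℤᵈ.∣m⇒∣m*n {+ p * + p} {+ m} t p²∣m) exactₚ
        , ≡.subst (+ p * + p ∣_) (≡.sym m′≡) (ℤᵈ.∣n⇒∣m*n {+ p * + p} (+ q * + q) {+ m} p²∣m)

-- Infinitely many prime divisors

∣z∣≤∣a+z∣+∣a∣ : ∀ a z → ∣ z ∣ ℕ.≤ ∣ a + z ∣ ℕ.+ ∣ a ∣
∣z∣≤∣a+z∣+∣a∣ a z = ≡.subst (λ y → ∣ y ∣ ℕ.≤ ∣ a + z ∣ ℕ.+ ∣ a ∣)
  (solve 2 (λ a z → (a :+ z) :- a := z) ≡.refl a z) (ℤₚ.∣i-j∣≤∣i∣+∣j∣ (a + z) a)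

-- Beyond `N` the value of `f` is a nonzero integer, so multiplying it by `n` gives absolute value
-- at least `n`; the threshold leaves room for `C` and for the loss of `∣ a ∣`.
grow : ∀ a f {N} → (∀ n → N ℕ.≤ n → eval f (+ n) ≢ 0ℤ) → ∀ C n →
       N ℕ.+ suc (C ℕ.+ ∣ a ∣) ℕ.≤ n → C ℕ.< ∣ eval (a ∷ f) (+ n) ∣
grow a f {N} f≢0 C n le = ℕₚ.+-cancelʳ-≤ ∣ a ∣ (suc C) _ (begin
  suc C ℕ.+ ∣ a ∣                    ≤⟨ ℕₚ.m≤n+m _ N ⟩
  N ℕ.+ suc (C ℕ.+ ∣ a ∣)            ≤⟨ le ⟩
  n                                  ≤⟨ ℕₚ.m≤m*n n ∣ eval f (+ n) ∣ {{ℕ.≢-nonZero nz}} ⟩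
  n ℕ.* ∣ eval f (+ n) ∣             ≡⟨ ℤₚ.abs-* (+ n) (eval f (+ n)) ⟨
  ∣ + n * eval f (+ n) ∣             ≤⟨ ∣z∣≤∣a+z∣+∣a∣ a (+ n * eval f (+ n)) ⟩
  ∣ eval (a ∷ f) (+ n) ∣ ℕ.+ ∣ a ∣   ∎)
  where
  open ℕₚ.≤-Reasoning
  nz : ∣ eval f (+ n) ∣ ≢ 0
  nz = f≢0 n (ℕₚ.≤-trans (ℕₚ.m≤m+n N _) le) ∘ ℤₚ.∣i∣≡0⇒i≡0

-- Induction on the coefficient list replaces a leading-term estimate: a tail that is eventually
-- nonzero feeds `grow`, and a zero tail leaves only the constant term.
zero-or-eventually-nonzero : ∀ f → (∀ k → ℤ[x].coeff f k ≡ 0ℤ) ⊎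
                             (∃[ N ] ∀ n → N ℕ.≤ n → eval f (+ n) ≢ 0ℤ)
zero-or-eventually-nonzero [] = inj₁ λ _ → ≡.refl
zero-or-eventually-nonzero (a ∷ f) with zero-or-eventually-nonzero f
... | inj₂ (N , f≢0) = inj₂ (_ , λ n le eq → ℕₚ.<⇒≢ (grow a f f≢0 0 n le) (≡.cong ∣_∣ (≡.sym eq)))
... | inj₁ f≡0 with a ℤₚ.≟ 0ℤ
...   | yes ≡.refl = inj₁ λ { zero → ≡.refl ; (suc k) → f≡0 k }
...   | no  a≢0    = inj₂ (0 , λ n _ eq → a≢0 (≡.trans (≡.sym (value n)) eq))
  where
  value : ∀ n → eval (a ∷ f) (+ n) ≡ a
  value n = ≡.trans (≡.cong (λ y → a + + n * y) (Evaluation.eval-≈0 ℤₚ.+-*-commutativeRing f (+ n) f≡0))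
    (solve 2 (λ a n → a :+ n :* con 0ℤ := a) ≡.refl a (+ n))

-- Nonconstancy puts a nonzero coefficient in the tail, which is therefore eventually nonzero.
unbounded : ∀ f → Nonconstant f → ∀ C → ∃[ N ] ∀ n → N ℕ.≤ n → C ℕ.< ∣ eval f (+ n) ∣
unbounded []      (n     , _       , fₙ≢0 , _) C = ⊥-elim (fₙ≢0 ≡.refl)
unbounded (a ∷ f) (suc n , s≤s z≤n , fₙ≢0 , _) C with zero-or-eventually-nonzero f
... | inj₁ f≡0       = ⊥-elim (fₙ≢0 (f≡0 n))
... | inj₂ (N , f≢0) = _ , grow a f f≢0 C

prime-divisor : ∀ n → 1 ℕ.< n → ∃[ p ] Prime p × p ℕᵈ.∣ n
prime-divisor n@(suc _) 1<n with factorise n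
... | record { factors = [] ; isFactorisation = eq } = ⊥-elim (ℕₚ.<⇒≢ 1<n (≡.sym eq))
... | record { factors = p ∷ ps ; isFactorisation = eq ; factorsPrime = pp ∷ _ } =
  p , pp , ≡.subst (p ℕᵈ.∣_) (≡.sym eq) (ℕᵈ.m∣m*n (product ps))

-- Schur's argument: with v = f(m) ≠ 0, every value f(m + K|v|x) is v (1 + K…),
-- and once it exceeds |v| the second factor has a prime divisor, prime to K.
schur : ∀ f → Nonconstant f → ∀ K → K ≢ 0 →
        ∃[ p ] Prime p × ¬ (+ p ∣ + K) × ∃[ n ] + p ∣ eval f n
schur f nc K K≢0 with unbounded f nc 0
... | m , large with unbounded f nc ∣ eval f (+ m) ∣
... | N , larger with eval-congruence f (+ m) (+ (K ℕ.* ∣ eval f (+ m) ∣ ℕ.* N)) | ℤᵈ.m∣∣m∣ {eval f (+ m)}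
... | w , eq | divides e ∣v∣≡ev = conclude (prime-divisor ∣ g ∣ 1<∣g∣)
  where
  v = eval f (+ m)
  -- The factor `N` puts `m + y` at or beyond `N`, where values exceed `∣ v ∣`. The quotient `e` of
  -- `∣ v ∣` by `v` lets `v` be factored out.
  y = K ℕ.* ∣ v ∣ ℕ.* N
  g = 1ℤ + + K * (e * + N * w)

  value : eval f (+ (m ℕ.+ y)) ≡ v * g
  value = begin
    eval f (+ m + + y)                ≡⟨ eq ⟩
    v + + y * w                       ≡⟨ ≡.cong (λ z → v + z * w) (≡.trans (ℤₚ.pos-* (K ℕ.* ∣ v ∣) N)
                                           (≡.cong (_* + N) (ℤₚ.pos-* K ∣ v ∣))) ⟩
    v + + K * + ∣ v ∣ * + N * w       ≡⟨ ≡.cong (λ z → v + + K * z * + N * w) ∣v∣≡ev ⟩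
    v + + K * (e * v) * + N * w
      ≡⟨ solve 5 (λ v k e n w → v :+ k :* (e :* v) :* n :* w := v :* (con 1ℤ :+ k :* (e :* n :* w)))
           ≡.refl v (+ K) e (+ N) w ⟩
    v * g                             ∎
    where open ≡.≡-Reasoning

  N≤m+y : N ℕ.≤ m ℕ.+ y
  N≤m+y = begin
    N        ≤⟨ ℕₚ.m≤n*m N (K ℕ.* ∣ v ∣) {{ℕₚ.m*n≢0 K ∣ v ∣ {{ℕ.≢-nonZero K≢0}} {{ℕ.>-nonZero (large m ℕₚ.≤-refl)}}}} ⟩
    y        ≤⟨ ℕₚ.m≤n+m y m ⟩
    m ℕ.+ y  ∎
    where open ℕₚ.≤-Reasoning

  1<∣g∣ : 1 ℕ.< ∣ g ∣
  1<∣g∣ = ℕₚ.*-cancelˡ-< (∣ v ∣) 1 (∣ g ∣) (begin-strict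
    ∣ v ∣ ℕ.* 1                ≡⟨ ℕₚ.*-identityʳ ∣ v ∣ ⟩
    ∣ v ∣                      <⟨ larger (m ℕ.+ y) N≤m+y ⟩
    ∣ eval f (+ (m ℕ.+ y)) ∣   ≡⟨ ≡.cong ∣_∣ value ⟩
    ∣ v * g ∣                  ≡⟨ ℤₚ.abs-* v g ⟩
    ∣ v ∣ ℕ.* ∣ g ∣            ∎)
    where open ℕₚ.≤-Reasoning

  conclude : ∃[ p ] Prime p × p ℕᵈ.∣ ∣ g ∣ →
             ∃[ p ] Prime p × ¬ (+ p ∣ + K) × ∃[ n ] + p ∣ eval f n
  conclude (p , pp , p∣∣g∣) = p , pp ,
    (λ p∣K → prime∤1 pp (ℤᵈ.∣m+n∣n⇒∣m {m = 1ℤ} p∣g (ℤᵈ.∣m⇒∣m*n (e * + N * w) p∣K))) ,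
    + (m ℕ.+ y) , ≡.subst (+ p ∣_) (≡.sym value) (ℤᵈ.∣n⇒∣m*n v p∣g)
    where
    p∣g : + p ∣ g
    p∣g = ∣ᵤ⇒∣ p∣∣g∣

-- Rational values

module ℚ-Eval = Evaluation ℚₚ.+-*-commutativeRing

fromℤ-+ : ∀ a b → fromℤ (a + b) ≡ fromℤ a ℚ.+ fromℤ b
fromℤ-+ a b = ℚₚ.toℚᵘ-injective (ℚᵘₚ.≃-trans
  (ℚᵘ.*≡* (solve 2 (λ a b → (a :+ b) :* con 1ℤ := (a :* con 1ℤ :+ b :* con 1ℤ) :* con 1ℤ) ≡.refl a b))
  (ℚᵘₚ.≃-sym (ℚₚ.toℚᵘ-homo-+ (fromℤ a) (fromℤ b))))

fromℤ-* : ∀ a b → fromℤ (a * b) ≡ fromℤ a ℚ.* fromℤ b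
fromℤ-* a b = ℚₚ.toℚᵘ-injective (ℚᵘₚ.≃-trans (ℚᵘ.*≡* ≡.refl)
  (ℚᵘₚ.≃-sym (ℚₚ.toℚᵘ-homo-* (fromℤ a) (fromℤ b))))

fromℤ-injective : ∀ {a b} → fromℤ a ≡ fromℤ b → a ≡ b
fromℤ-injective = ≡.cong ℚ.↥_

fromℤ-↧ : ∀ p → fromℤ (ℚ.↧ p) ℚ.* p ≡ fromℤ (ℚ.↥ p)
fromℤ-↧ p@record{} = ℚₚ.toℚᵘ-injective (ℚᵘₚ.≃-trans (ℚₚ.toℚᵘ-homo-* (fromℤ (ℚ.↧ p)) p)
  (ℚᵘ.*≡* (≡.trans (ℤₚ.*-identityʳ _) (≡.trans (ℤₚ.*-comm (ℚ.↧ p) (ℚ.↥ p))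
    (≡.cong (λ z → ℚ.↥ p * + suc z) (≡.sym (ℕₚ.+-identityʳ _)))))))

eval-fromℤ : ∀ f n → ℚ[x].eval (toℚ[x] f) (fromℤ n) ≡ fromℤ (eval f n)
eval-fromℤ []      n = ≡.refl
eval-fromℤ (a ∷ f) n = begin
  fromℤ a ℚ.+ fromℤ n ℚ.* ℚ[x].eval (toℚ[x] f) (fromℤ n)
    ≡⟨ ≡.cong (λ z → fromℤ a ℚ.+ fromℤ n ℚ.* z) (eval-fromℤ f n) ⟩
  fromℤ a ℚ.+ fromℤ n ℚ.* fromℤ (eval f n)
    ≡⟨ ≡.cong (fromℤ a ℚ.+_) (fromℤ-* n (eval f n)) ⟨
  fromℤ a ℚ.+ fromℤ (n * eval f n)
    ≡⟨ fromℤ-+ a (n * eval f n) ⟨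
  fromℤ (a + n * eval f n) ∎
  where open ≡.≡-Reasoning

eval′-fromℤ : ∀ f n → ℚ[x].eval (ℚ[x].deriv (toℚ[x] f)) (fromℤ n) ≡ fromℤ (eval′ f n)
eval′-fromℤ []      n = ≡.refl
eval′-fromℤ (a ∷ f) n = begin
  ℚ[x].eval (ℚ[x].deriv (toℚ[x] (a ∷ f))) (fromℤ n)
    ≡⟨ ℚ-Eval.eval-deriv-∷ (fromℤ a) (toℚ[x] f) (fromℤ n) ⟩
  ℚ[x].eval (toℚ[x] f) (fromℤ n) ℚ.+ fromℤ n ℚ.* ℚ[x].eval (ℚ[x].deriv (toℚ[x] f)) (fromℤ n)
    ≡⟨ ≡.cong₂ (λ u v → u ℚ.+ fromℤ n ℚ.* v) (eval-fromℤ f n) (eval′-fromℤ f n) ⟩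
  fromℤ (eval f n) ℚ.+ fromℤ n ℚ.* fromℤ (eval′ f n)
    ≡⟨ ≡.cong (fromℤ (eval f n) ℚ.+_) (fromℤ-* n (eval′ f n)) ⟨
  fromℤ (eval f n) ℚ.+ fromℤ (n * eval′ f n)
    ≡⟨ fromℤ-+ (eval f n) (n * eval′ f n) ⟨
  fromℤ (eval f n + n * eval′ f n)
    ≡⟨ ≡.cong fromℤ (Evaluation.eval-deriv-∷ ℤₚ.+-*-commutativeRing a f n) ⟨
  fromℤ (eval′ (a ∷ f) n) ∎
  where open ≡.≡-Reasoning

-- The witness is the product of the denominators of the coefficients, so it is independent of `n`.
clear-denominators : ∀ u → ∃[ c ] c ≢ 0 ×
  (∀ n → ∃[ z ] fromℤ (+ c) ℚ.* ℚ[x].eval u (fromℤ n) ≡ fromℤ z)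
clear-denominators [] = 1 , (λ ()) , λ n → 0ℤ , ≡.refl
clear-denominators (a ∷ u) with clear-denominators u
... | c , c≢0 , integral = ℚ.↧ₙ a ℕ.* c , nonzero , λ n → combine n (integral n)
  where
  nonzero : ℚ.↧ₙ a ℕ.* c ≢ 0
  nonzero eq with ℕₚ.m*n≡0⇒m≡0∨n≡0 (ℚ.↧ₙ a) eq
  ... | inj₂ c≡0 = c≢0 c≡0
  combine : ∀ n → ∃[ z ] fromℤ (+ c) ℚ.* ℚ[x].eval u (fromℤ n) ≡ fromℤ z →
            ∃[ z ] fromℤ (+ (ℚ.↧ₙ a ℕ.* c)) ℚ.* ℚ[x].eval (a ∷ u) (fromℤ n) ≡ fromℤ z
  combine n (z , eq) = + c * ℚ.↥ a + ℚ.↧ a * (n * z) , (begin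
    fromℤ (+ (ℚ.↧ₙ a ℕ.* c)) ℚ.* (a ℚ.+ x ℚ.* U)
      ≡⟨ ≡.cong (ℚ._* (a ℚ.+ x ℚ.* U)) (≡.trans (≡.cong fromℤ (ℤₚ.pos-* (ℚ.↧ₙ a) c)) (fromℤ-* (ℚ.↧ a) (+ c))) ⟩
    (d ℚ.* C) ℚ.* (a ℚ.+ x ℚ.* U)
      ≡⟨ rearrange-∷ d C a x U ⟩
    C ℚ.* (d ℚ.* a) ℚ.+ d ℚ.* (x ℚ.* (C ℚ.* U))
      ≡⟨ ≡.cong₂ (λ s t → C ℚ.* s ℚ.+ d ℚ.* (x ℚ.* t)) (fromℤ-↧ a) eq ⟩
    C ℚ.* fromℤ (ℚ.↥ a) ℚ.+ d ℚ.* (x ℚ.* fromℤ z)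
      ≡⟨ ≡.cong₂ (λ s t → s ℚ.+ d ℚ.* t) (fromℤ-* (+ c) (ℚ.↥ a)) (fromℤ-* n z) ⟨
    fromℤ (+ c * ℚ.↥ a) ℚ.+ d ℚ.* fromℤ (n * z)
      ≡⟨ ≡.cong (fromℤ (+ c * ℚ.↥ a) ℚ.+_) (fromℤ-* (ℚ.↧ a) (n * z)) ⟨
    fromℤ (+ c * ℚ.↥ a) ℚ.+ fromℤ (ℚ.↧ a * (n * z))
      ≡⟨ fromℤ-+ (+ c * ℚ.↥ a) (ℚ.↧ a * (n * z)) ⟨
    fromℤ (+ c * ℚ.↥ a + ℚ.↧ a * (n * z)) ∎)
    where
    open ≡.≡-Reasoning
    d = fromℤ (ℚ.↧ a)
    C = fromℤ (+ c)
    x = fromℤ n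
    U = ℚ[x].eval u x

-- Evaluating the Bézout identity at `n` and multiplying by `c₁ * c₂` writes this constant as an
-- integral combination of the two values.
separable⇒common-divisor : ∀ f → SeparableOverℚ f →
  ∃[ c ] c ≢ 0 × (∀ n d → d ∣ eval f n → d ∣ eval′ f n → d ∣ + c)
separable⇒common-divisor f (u , v , bezout)
  with clear-denominators u | clear-denominators v
... | c₁ , c₁≢0 , int₁ | c₂ , c₂≢0 , int₂ = c₁ ℕ.* c₂ , nonzero , λ n d d∣f d∣f′ →
  ≡.subst (d ∣_) (≡.sym (identity n))
    (ℤᵈ.∣m∣n⇒∣m+n (ℤᵈ.∣n⇒∣m*n (+ c₂ * proj₁ (int₁ n)) d∣f) (ℤᵈ.∣n⇒∣m*n (+ c₁ * proj₁ (int₂ n)) d∣f′))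
  where
  nonzero : c₁ ℕ.* c₂ ≢ 0
  nonzero eq = [ c₁≢0 , c₂≢0 ]′ (ℕₚ.m*n≡0⇒m≡0∨n≡0 c₁ eq)

  identity : ∀ n → + (c₁ ℕ.* c₂) ≡
    + c₂ * proj₁ (int₁ n) * eval f n + + c₁ * proj₁ (int₂ n) * eval′ f n
  identity n with int₁ n | int₂ n
  ... | z₁ , eq₁ | z₂ , eq₂ = fromℤ-injective (begin
    fromℤ (+ (c₁ ℕ.* c₂))
      ≡⟨ ≡.trans (≡.cong fromℤ (ℤₚ.pos-* c₁ c₂)) (fromℤ-* (+ c₁) (+ c₂)) ⟩
    C₁ ℚ.* C₂
      ≡⟨ ℚₚ.*-identityʳ (C₁ ℚ.* C₂) ⟨
    C₁ ℚ.* C₂ ℚ.* ℚ.1ℚ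
      ≡⟨ ≡.cong (C₁ ℚ.* C₂ ℚ.*_) unit ⟨
    C₁ ℚ.* C₂ ℚ.* (U ℚ.* fromℤ (eval f n) ℚ.+ V ℚ.* fromℤ (eval′ f n))
      ≡⟨ rearrange-bezout C₁ C₂ U V (fromℤ (eval f n)) (fromℤ (eval′ f n)) ⟩
    C₂ ℚ.* (C₁ ℚ.* U) ℚ.* fromℤ (eval f n) ℚ.+ C₁ ℚ.* (C₂ ℚ.* V) ℚ.* fromℤ (eval′ f n)
      ≡⟨ ≡.cong₂ (λ s t → C₂ ℚ.* s ℚ.* fromℤ (eval f n) ℚ.+ C₁ ℚ.* t ℚ.* fromℤ (eval′ f n)) eq₁ eq₂ ⟩
    C₂ ℚ.* fromℤ z₁ ℚ.* fromℤ (eval f n) ℚ.+ C₁ ℚ.* fromℤ z₂ ℚ.* fromℤ (eval′ f n)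
      ≡⟨ ≡.cong₂ ℚ._+_ (fromℤ-*³ (+ c₂) z₁ (eval f n)) (fromℤ-*³ (+ c₁) z₂ (eval′ f n)) ⟨
    fromℤ (+ c₂ * z₁ * eval f n) ℚ.+ fromℤ (+ c₁ * z₂ * eval′ f n)
      ≡⟨ fromℤ-+ (+ c₂ * z₁ * eval f n) (+ c₁ * z₂ * eval′ f n) ⟨
    fromℤ (+ c₂ * z₁ * eval f n + + c₁ * z₂ * eval′ f n) ∎)
    where
    open ≡.≡-Reasoning
    x = fromℤ n
    C₁ = fromℤ (+ c₁)
    C₂ = fromℤ (+ c₂)
    U = ℚ[x].eval u x
    V = ℚ[x].eval v x
    fromℤ-*³ : ∀ a b c → fromℤ (a * b * c) ≡ fromℤ a ℚ.* fromℤ b ℚ.* fromℤ c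
    fromℤ-*³ a b c = ≡.trans (fromℤ-* (a * b) c) (≡.cong (ℚ._* fromℤ c) (fromℤ-* a b))
    fℚ = toℚ[x] f
    unit : U ℚ.* fromℤ (eval f n) ℚ.+ V ℚ.* fromℤ (eval′ f n) ≡ ℚ.1ℚ
    unit = begin
      U ℚ.* fromℤ (eval f n) ℚ.+ V ℚ.* fromℤ (eval′ f n)
        ≡⟨ ≡.cong₂ (λ s t → U ℚ.* s ℚ.+ V ℚ.* t) (eval-fromℤ f n) (eval′-fromℤ f n) ⟨
      U ℚ.* ℚ[x].eval fℚ x ℚ.+ V ℚ.* ℚ[x].eval (ℚ[x].deriv fℚ) x
        ≡⟨ ≡.cong₂ ℚ._+_ (ℚ-Eval.eval-*ₚ u fℚ x) (ℚ-Eval.eval-*ₚ v (ℚ[x].deriv fℚ) x) ⟨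
      ℚ[x].eval (u ℚ[x].*ₚ fℚ) x ℚ.+ ℚ[x].eval (v ℚ[x].*ₚ ℚ[x].deriv fℚ) x
        ≡⟨ ℚ-Eval.eval-+ₚ (u ℚ[x].*ₚ fℚ) (v ℚ[x].*ₚ ℚ[x].deriv fℚ) x ⟨
      ℚ[x].eval (u ℚ[x].*ₚ fℚ ℚ[x].+ₚ v ℚ[x].*ₚ ℚ[x].deriv fℚ) x
        ≡⟨ ℚ-Eval.eval-congₚ (u ℚ[x].*ₚ fℚ ℚ[x].+ₚ v ℚ[x].*ₚ ℚ[x].deriv fℚ) ℚ[x].1ₚ x bezout ⟩
      ℚ.1ℚ ℚ.+ x ℚ.* ℚ.0ℚ
        ≡⟨ ≡.trans (≡.cong (ℚ.1ℚ ℚ.+_) (ℚₚ.*-zeroʳ x)) (ℚₚ.+-identityʳ ℚ.1ℚ) ⟩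
      ℚ.1ℚ ∎

-- Squarefree parts

-- Strong induction on `∣ N ∣`: dividing out the square of some `m > 1` lowers it, and if there is
-- no such `m` then `N` is squarefree. The sign stays in `d`.
squarefree-decomposition : ∀ N → N ≢ 0ℤ → ∃[ d ] ∃[ s ] Squarefree d × N ≡ d * (s * s)
squarefree-decomposition N = go N (<-wellFounded ∣ N ∣)
  where
  go : ∀ N → Acc ℕ._<_ ∣ N ∣ → N ≢ 0ℤ → ∃[ d ] ∃[ s ] Squarefree d × N ≡ d * (s * s)
  go N (acc rec) N≢0
    -- If `m * m` divides the nonzero `N`, then `m ≤ m * m ≤ ∣ N ∣`, so the search below `suc ∣ N ∣`
    -- is exhaustive.
    with ℕₚ.anyUpTo? (λ m → (1 ℕₚ.<? m) ×-dec ((m ℕ.* m) ℕᵈ.∣? ∣ N ∣)) (suc ∣ N ∣)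
  ... | no none = N , 1ℤ ,
    record { nonZero = ℤ.≢-nonZero N≢0 ; squarefree = λ m m²∣N → unit m (≡.subst (ℕᵈ._∣ ∣ N ∣) (ℤₚ.abs-* m m) (∣⇒∣ᵤ m²∣N)) } ,
    ≡.sym (ℤₚ.*-identityʳ N)
    where
    ∣N∣≢0 : ℕ.NonZero ∣ N ∣
    ∣N∣≢0 = ℤ.≢-nonZero N≢0
    unit : ∀ m → ∣ m ∣ ℕ.* ∣ m ∣ ℕᵈ.∣ ∣ N ∣ → ∣ m ∣ ≡ 1
    unit m m²∣N with ∣ m ∣
    ... | 0 = ⊥-elim (N≢0 (ℤₚ.∣i∣≡0⇒i≡0 (ℕᵈ.0∣⇒≡0 m²∣N)))
    ... | 1 = ≡.refl
    ... | k@(suc (suc _)) = ⊥-elim (none (k , s≤s (ℕₚ.≤-trans (ℕₚ.m≤m*n k k) (ℕᵈ.∣⇒≤ {{∣N∣≢0}} m²∣N)) , s≤s (s≤s z≤n) , m²∣N))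
  ... | yes (m , _ , 1<m , m²∣N) with ∣ᵤ⇒∣ {+ (m ℕ.* m)} {N} m²∣N
  ...   | divides N′ N≡ = reduce′ (go N′ (rec smaller) N′≢0)
    where
    N′≢0 : N′ ≢ 0ℤ
    N′≢0 ≡.refl = N≢0 N≡
    smaller : ∣ N′ ∣ ℕ.< ∣ N ∣
    smaller = begin-strict
      ∣ N′ ∣                 <⟨ ℕₚ.m<m*n ∣ N′ ∣ (m ℕ.* m) {{ℤ.≢-nonZero N′≢0}} (ℕₚ.*-mono-< {1} {m} {1} {m} 1<m 1<m) ⟩
      ∣ N′ ∣ ℕ.* (m ℕ.* m)   ≡⟨ ℤₚ.abs-* N′ (+ (m ℕ.* m)) ⟨
      ∣ N′ * + (m ℕ.* m) ∣   ≡⟨ ≡.cong ∣_∣ N≡ ⟨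
      ∣ N ∣                  ∎
      where open ℕₚ.≤-Reasoning
    reduce′ : ∃[ d ] ∃[ s ] Squarefree d × N′ ≡ d * (s * s) →
              ∃[ d ] ∃[ s ] Squarefree d × N ≡ d * (s * s)
    reduce′ (d , s , sf , eq) = d , s * + m , sf , (begin
      N                          ≡⟨ N≡ ⟩
      N′ * + (m ℕ.* m)           ≡⟨ ≡.cong₂ _*_ eq (ℤₚ.pos-* m m) ⟩
      d * (s * s) * (+ m * + m)
        ≡⟨ solve 3 (λ d s m → d :* (s :* s) :* (m :* m) := d :* ((s :* m) :* (s :* m))) ≡.refl d s (+ m) ⟩
      d * (s * + m * (s * + m))  ∎)
      where open ≡.≡-Reasoning

-- If `q` divided `s * s` it would divide `s`, and its square would divide the value; so `q` must
-- come from `d`.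
exact⇒∣squarefreePart : ∀ {q} → Prime q → ∀ d s → ExactlyDivides q (d * (s * s)) → + q ∣ d
exact⇒∣squarefreePart {q} pq d s (q∣ , q²∤) with prime-∣* pq d (s * s) q∣
... | inj₁ q∣d  = q∣d
... | inj₂ q∣s² = ⊥-elim (q²∤ (ℤᵈ.∣n⇒∣m*n d (square ([ id , id ]′ (prime-∣* pq s s q∣s²)))))
  where
  square : + q ∣ s → + q * + q ∣ s * s
  square q∣s = ℤᵈ.∣-trans (ℤᵈ.*-monoʳ-∣ (+ q) q∣s) (ℤᵈ.*-monoˡ-∣ s q∣s)

∈𝒮-integer : ∀ f n d s → Squarefree d → eval f n ≢ 0ℤ → eval f n ≡ d * (s * s) → d ∈𝒮 f
∈𝒮-integer f n d s sf fn≢0 eq =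
  fromℤ n , (λ v≡0 → fn≢0 (fromℤ-injective (≡.trans (≡.sym (eval-fromℤ f n)) v≡0))) ,
  sf , fromℤ s , (begin
    ℚ[x].eval (toℚ[x] f) (fromℤ n) ℚ.* 1/d
      ≡⟨ ≡.cong (ℚ._* 1/d) (≡.trans (eval-fromℤ f n) (≡.trans (≡.cong fromℤ eq) (fromℤ-* d (s * s)))) ⟩
    fromℤ d ℚ.* fromℤ (s * s) ℚ.* 1/d
      ≡⟨ ≡.cong (ℚ._* 1/d) (ℚₚ.*-comm (fromℤ d) (fromℤ (s * s))) ⟩
    fromℤ (s * s) ℚ.* fromℤ d ℚ.* 1/d
      ≡⟨ ℚₚ.*-assoc (fromℤ (s * s)) (fromℤ d) 1/d ⟩
    fromℤ (s * s) ℚ.* (fromℤ d ℚ.* 1/d)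
      ≡⟨ ≡.cong (fromℤ (s * s) ℚ.*_) (ℚₚ.*-inverseʳ (fromℤ d)) ⟩
    fromℤ (s * s) ℚ.* ℚ.1ℚ
      ≡⟨ ℚₚ.*-identityʳ _ ⟩
    fromℤ (s * s)
      ≡⟨ fromℤ-* s s ⟩
    fromℤ s ℚ.* fromℤ s ∎)
  where
  open ≡.≡-Reasoning
  instance
    d≢0 : ℤ.NonZero d
    d≢0 = Squarefree.nonZero sf
  1/d = ℚ.1/ fromℤ d

-- Avoiding a finite list and assembling the construction.

-- A prime not dividing `m` divides no nonzero member of `ds`. Zero entries are skipped, since
-- squarefree parts are nonzero.
nonzero-multiple : ∀ (ds : List ℤ) → ∃[ m ] m ≢ 0 × (∀ {d} → d ∈ ds → d ≢ 0ℤ → d ∣ + m)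
nonzero-multiple [] = 1 , (λ ()) , λ ()
nonzero-multiple (d ∷ ds) with nonzero-multiple ds | d ℤₚ.≟ 0ℤ
... | m , m≢0 , multiple | yes ≡.refl =
  m , m≢0 , λ { (here d≡0) d≢0 → ⊥-elim (d≢0 d≡0) ; (there d∈) → multiple d∈ }
... | m , m≢0 , multiple | no d≢0 = ∣ d ∣ ℕ.* m ,
  (λ eq → [ d≢0 ∘ ℤₚ.∣i∣≡0⇒i≡0 , m≢0 ]′ (ℕₚ.m*n≡0⇒m≡0∨n≡0 ∣ d ∣ eq)) ,
  λ { (here ≡.refl) _ → ∣ᵤ⇒∣ (ℕᵈ.m∣m*n m)
    ; (there d∈) nz   → ∣ᵤ⇒∣ (ℕᵈ.∣n⇒∣m*n ∣ d ∣ (∣⇒∣ᵤ (multiple d∈ nz))) }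

-- `schur` is applied to `c * K`, where `c` is a multiple of every common divisor of a value of `f`
-- and its derivative at the same integer; a prime not dividing `c` cannot divide both.
fresh-simpleRoot : ∀ f → Nonconstant f → SeparableOverℚ f → ∀ K → K ≢ 0 →
  ∃[ p ] ¬ (+ p ∣ + K) × Prime p × ∃[ a ] SimpleRoot f p a
fresh-simpleRoot f nc sep K K≢0 = build (separable⇒common-divisor f sep)
  where
  build : ∃[ c ] c ≢ 0 × (∀ n d → d ∣ eval f n → d ∣ eval′ f n → d ∣ + c) →
          ∃[ p ] ¬ (+ p ∣ + K) × Prime p × ∃[ a ] SimpleRoot f p a
  build (c , c≢0 , common) = simple (schur f nc (c ℕ.* K) cK≢0)
    where
    cK≢0 : c ℕ.* K ≢ 0
    cK≢0 eq = [ c≢0 , K≢0 ]′ (ℕₚ.m*n≡0⇒m≡0∨n≡0 c eq)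
    simple : ∃[ p ] Prime p × ¬ (+ p ∣ + (c ℕ.* K)) × ∃[ n ] + p ∣ eval f n →
             ∃[ p ] ¬ (+ p ∣ + K) × Prime p × ∃[ a ] SimpleRoot f p a
    simple (p , pp , p∤cK , n , p∣fn) =
      p , (λ p∣K → p∤cK (∣ᵤ⇒∣ (ℕᵈ.∣n⇒∣m*n c (∣⇒∣ᵤ p∣K)))) , pp , n , p∣fn ,
      λ p∣f′n → p∤cK (∣ᵤ⇒∣ (ℕᵈ.∣m⇒∣m*n K (∣⇒∣ᵤ (common n (+ p) p∣fn p∣f′n))))

squarefreePart-value : ∀ f n → eval f n ≢ 0ℤ → ∃[ d ] d ≢ 0ℤ × d ∈𝒮 f ×
  (∀ {q} → Prime q → ExactlyDivides q (eval f n) → + q ∣ d)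
squarefreePart-value f n fn≢0 = build (squarefree-decomposition (eval f n) fn≢0)
  where
  build : ∃[ d ] ∃[ s ] Squarefree d × eval f n ≡ d * (s * s) → ∃[ d ] d ≢ 0ℤ × d ∈𝒮 f ×
          (∀ {q} → Prime q → ExactlyDivides q (eval f n) → + q ∣ d)
  build (d , s , sf , eq) = d ,
    ℕ.≢-nonZero⁻¹ (∣ d ∣) {{Squarefree.nonZero sf}} ∘ ≡.cong ∣_∣ ,
    ∈𝒮-integer f n d s sf fn≢0 eq ,
    λ {q} pq exact → exact⇒∣squarefreePart pq d s (≡.subst (ExactlyDivides q) eq exact)

exact⇒≢0 : ∀ {q z} → ExactlyDivides q z → z ≢ 0ℤ
exact⇒≢0 {q} (_ , q²∤z) ≡.refl = q²∤z (divides 0ℤ ≡.refl)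

proposition2p4 : (f : ℤ[x].Poly) → Nonconstant f → SeparableOverℚ f → (T : List ℕ) → All (_∈R f) T → InfinitelyMany (λ d → d ∈𝒮 f × All (λ q → + q ∣ d) T)
proposition2p4 f nc sep T T⊆R ds = avoid (nonzero-multiple ds)
  where
  Goal : Set
  Goal = ∃[ d ] (d ∉ ds × d ∈𝒮 f × All (λ q → + q ∣ d) T)

  exactRoot : ∀ {q} → Prime q × ∃[ a ] SimpleRoot f q a →
              Prime q × ∃[ a ] ExactlyDivides q (eval f a)
  exactRoot (pq , a , simple) = pq , lift-simpleRoot {f} {_} {a} pq simple

  avoid : ∃[ m ] m ≢ 0 × (∀ {d} → d ∈ ds → d ≢ 0ℤ → d ∣ + m) → Goal
  avoid (m , m≢0 , multiple) = choose (fresh-simpleRoot f nc sep m m≢0)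
    where
    choose : ∃[ p ] ¬ (+ p ∣ + m) × Prime p × ∃[ a ] SimpleRoot f p a → Goal
    -- The prime `p` may already lie in `T`; `simultaneous` admits repetitions.
    choose (p , p∤m , root@(pp , _)) = finish (simultaneous f (p ∷ T)
      (exactRoot root ∷ All.map (λ q∈R → exactRoot (∈R⇒simpleRoot nc q∈R)) T⊆R))
      where
      finish : ∃[ n ] ∃[ M ] All (ExactAt f n M) (p ∷ T) ×
                 (∀ {q} → Prime q → q ℕᵈ.∣ M → q ∈ p ∷ T) → Goal
      finish (n , M , (exactₚ , _) ∷ exacts , _) =
        conclude (squarefreePart-value f n (exact⇒≢0 exactₚ))
        where
        conclude : ∃[ d ] d ≢ 0ℤ × d ∈𝒮 f ×
                     (∀ {q} → Prime q → ExactlyDivides q (eval f n) → + q ∣ d) → Goal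
        conclude (d , d≢0 , d∈𝒮 , divisible) = d ,
          -- If `d` were in `ds`, then `p` would divide `d`, which divides `m`.
          (λ d∈ds → p∤m (ℤᵈ.∣-trans (divisible pp exactₚ) (multiple d∈ds d≢0))) , d∈𝒮 ,
          All.zipWith (λ ((good , _) , exact , _) → divisible (Good.isPrime good) exact)
            (T⊆R , exacts)
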